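{- For every $\alpha\in[0,\infty]$, the level set $\{x\in(0,1):\lambda(x)=\alpha\}$ is uncountable and dense in $(0,1)$, where $\lambda(x)$ denotes the exponent of convergence of the sequence of Engel digits of $x$.
   Context: Engel series: let $T:[0,1)\to[0,1)$ be defined by $T(0)=0$ and $T(x)=x\lceil 1/x\rceil-1$ for $x\in(0,1)$, where $\lceil y\rceil$ is the least integer not less than $y$. For $x\in(0,1)$ put $d_1(x)=\lceil 1/x\rceil$ and $d_{n+1}(x)=d_1(T^n(x))$ for $n\ge1$, as long as $T^n(x)\neq0$; these positive integers are the digits of the Engel expansion $x=\frac1{d_1(x)}+\frac1{d_1(x)d_2(x)}+\cdots$. If $T^k(x)=0$ for some $k$, the digit sequence is finite (this happens exactly when $x$ is rational); otherwise it is infinite. Exponent of convergence: for $x\in(0,1)$, $\lambda(x)=\inf\{s\ge0:\sum_{n\ge1}d_n(x)^{ -s}<\infty\}\in[0,\infty]$, the sum being over all digits of $x$ and $\inf\emptyset=\infty$. In particular $\lambda(x)=0$ if $x$ is rational. -}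

module Defs where

open import Data.Nat.Base as ℕ using (ℕ; zero; suc)
import Data.Nat.Properties as ℕₚ
open import Data.Integer.Base as ℤ using (ℤ; +_; -[1+_]; _⊖_)
import Data.Integer.Properties as ℤₚ
import Data.Integer.Solver as ℤSolver
open import Data.Rational.Base as ℚ using (ℚ; 0ℚ; 1ℚ; _/_)
import Data.Rational.Properties as ℚₚ
import Data.Rational.Solver as ℚSolver
import Data.Rational.Unnormalised.Base as ℚᵘ
import Data.Rational.Unnormalised.Properties as ℚᵘₚ
open import Data.Maybe.Base using (Maybe; just; nothing)
open import Data.Product.Base using (∃; ∃-syntax; Σ-syntax; _×_; _,_)
open import Data.Sum.Base as Sum using (_⊎_; inj₁; inj₂)
open import Data.Unit.Base using (⊤)
open import Data.Empty using (⊥; ⊥-elim)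
open import Algebra.Bundles using (CommutativeRing)
open import Relation.Nullary.Negation.Core using (¬_)
open import Relation.Nullary.Decidable.Core using (Dec; yes; no)
open import Relation.Binary.PropositionalEquality
  using (_≡_; refl; sym; trans; cong; cong₂; subst; subst₂)

open import Algebra.Definitions.RawSemiring ℚ.+-*-rawSemiring using (_^_)
open import Algebra.Definitions.RawMonoid ℚ.+-0-rawMonoid using () renaming (_×_ to _·_)
open import Algebra.Properties.Semiring.Exp
  (CommutativeRing.semiring ℚₚ.+-*-commutativeRing) using (^-homo-*; ^-assocʳ)
open import Algebra.Properties.CommutativeSemiring.Exp
  (CommutativeRing.commutativeSemiring ℚₚ.+-*-commutativeRing) using (^-distrib-*)

------------------------------------------------------------------------
-- Rational arithmetic

fromℕ : ℕ → ℚ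
fromℕ n = + n / 1

fromℕ-suc : ∀ n → fromℕ (suc n) ≡ 1ℚ ℚ.+ fromℕ n
fromℕ-suc n = ℚₚ.toℚᵘ-injective
  (ℚᵘₚ.≃-trans (ℚₚ.toℚᵘ-fromℚᵘ (ℚᵘ.mkℚᵘ (+ suc n) 0))
  (ℚᵘₚ.≃-trans (ℚᵘ.*≡* (cong (λ z → (+ 1 ℤ.+ z) ℤ.* + 1) (sym (ℤₚ.*-identityʳ (+ n)))))
  (ℚᵘₚ.≃-trans (ℚᵘₚ.+-congʳ (ℚᵘ.mkℚᵘ (+ 1) 0)
                 (ℚᵘₚ.≃-sym (ℚₚ.toℚᵘ-fromℚᵘ (ℚᵘ.mkℚᵘ (+ n) 0))))
               (ℚᵘₚ.≃-sym (ℚₚ.toℚᵘ-homo-+ 1ℚ (fromℕ n))))))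

fromℕ-* : ∀ n p → fromℕ n ℚ.* p ≡ n · p
fromℕ-* zero    p = ℚₚ.*-zeroˡ p
fromℕ-* (suc n) p = trans (cong (ℚ._* p) (fromℕ-suc n))
  (trans (ℚₚ.*-distribʳ-+ p 1ℚ (fromℕ n)) (cong₂ ℚ._+_ (ℚₚ.*-identityˡ p) (fromℕ-* n p)))

0<1 : 0ℚ ℚ.< 1ℚ
0<1 = ℚ.*<* (ℤ.+<+ (ℕ.s≤s ℕ.z≤n))

<⇒0<- : ∀ {p q} → p ℚ.< q → 0ℚ ℚ.< q ℚ.- p
<⇒0<- {p} {q} p<q = subst (ℚ._< q ℚ.- p) (ℚₚ.+-inverseʳ p) (ℚₚ.+-monoˡ-< (ℚ.- p) p<q)

*-posˡ-< : ∀ {p q r} → 0ℚ ℚ.< r → p ℚ.< q → r ℚ.* p ℚ.< r ℚ.* q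
*-posˡ-< {r = r} 0<r p<q = ℚₚ.*-monoʳ-<-pos r {{ℚ.positive 0<r}} p<q

*-posʳ-< : ∀ {p q r} → 0ℚ ℚ.< r → p ℚ.< q → p ℚ.* r ℚ.< q ℚ.* r
*-posʳ-< {r = r} 0<r p<q = ℚₚ.*-monoˡ-<-pos r {{ℚ.positive 0<r}} p<q

*-posˡ-≤ : ∀ {p q r} → 0ℚ ℚ.< r → p ℚ.≤ q → r ℚ.* p ℚ.≤ r ℚ.* q
*-posˡ-≤ {r = r} 0<r p≤q =
  ℚₚ.*-monoˡ-≤-nonNeg r {{ℚ.nonNegative (ℚₚ.<⇒≤ 0<r)}} p≤q

*-posʳ-≤ : ∀ {p q r} → 0ℚ ℚ.< r → p ℚ.≤ q → p ℚ.* r ℚ.≤ q ℚ.* r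
*-posʳ-≤ {r = r} 0<r p≤q =
  ℚₚ.*-monoʳ-≤-nonNeg r {{ℚ.nonNegative (ℚₚ.<⇒≤ 0<r)}} p≤q

*-pos : ∀ {p q} → 0ℚ ℚ.< p → 0ℚ ℚ.< q → 0ℚ ℚ.< p ℚ.* q
*-pos {p} {q} 0<p 0<q = subst (ℚ._< p ℚ.* q) (ℚₚ.*-zeroʳ p) (*-posˡ-< 0<p 0<q)

reciprocal : ∀ {p} → 0ℚ ℚ.< p → ∃[ c ] 0ℚ ℚ.< c × p ℚ.* c ≡ 1ℚ
reciprocal {p} 0<p =
  let p>0 = ℚ.positive 0<p
      p≢0 = ℚₚ.pos⇒nonZero p {{p>0}}
  in  (ℚ.1/ p) {{p≢0}}
    , ℚₚ.positive⁻¹ ((ℚ.1/ p) {{p≢0}}) {{ℚₚ.1/pos⇒pos p {{p>0}}}}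
    , ℚₚ.*-inverseʳ p {{p≢0}}

reciprocal-pos : ∀ {p c} → 0ℚ ℚ.< p → p ℚ.* c ≡ 1ℚ → 0ℚ ℚ.< c
reciprocal-pos {p} {c} 0<p pc≡1 = ℚₚ.≰⇒> λ c≤0 →
  ℚₚ.<-irrefl refl (ℚₚ.<-≤-trans 0<1 (subst₂ ℚ._≤_ pc≡1 (ℚₚ.*-zeroʳ p) (*-posˡ-≤ 0<p c≤0)))

reciprocal-anti-< : ∀ {a b c d} → 0ℚ ℚ.< a → 0ℚ ℚ.< d → a ℚ.* c ≡ 1ℚ → b ℚ.* d ≡ 1ℚ →
                    a ℚ.< b → d ℚ.< c
reciprocal-anti-< 0<a 0<d ac≡1 bd≡1 a<b = ℚₚ.≰⇒> λ c≤d →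
  ℚₚ.<-irrefl (trans ac≡1 (sym bd≡1)) (ℚₚ.≤-<-trans (*-posˡ-≤ 0<a c≤d) (*-posʳ-< 0<d a<b))

<fromℕ : ∀ p → ∃[ n ] p ℚ.< fromℕ n
<fromℕ p@(ℚ.mkℚ i d _) = suc ℤ.∣ i ∣ , ℚₚ.toℚᵘ-cancel-<
  (ℚᵘₚ.<-respʳ-≃ (ℚᵘₚ.≃-sym (ℚₚ.toℚᵘ-fromℚᵘ (ℚᵘ.mkℚᵘ (+ suc ℤ.∣ i ∣) 0)))
    (ℚᵘ.*<* (lem i)))
  where
  lem : ∀ i → i ℤ.* + 1 ℤ.< + suc ℤ.∣ i ∣ ℤ.* + suc d
  lem i = subst (ℤ._< + suc ℤ.∣ i ∣ ℤ.* + suc d) (sym (ℤₚ.*-identityʳ i))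
    (ℤₚ.≤-<-trans (i≤∣i∣ i) (ℤ.+<+ (ℕₚ.<-≤-trans (ℕₚ.n<1+n ℤ.∣ i ∣) (ℕₚ.m≤m*n _ (suc d)))))
    where
    i≤∣i∣ : ∀ i → i ℤ.≤ + ℤ.∣ i ∣
    i≤∣i∣ (+ n)    = ℤₚ.≤-refl
    i≤∣i∣ -[1+ n ] = ℤ.-≤+

archimedean : ∀ {h} → 0ℚ ℚ.< h → ∀ p → ∃[ n ] p ℚ.< n · h
archimedean {h} 0<h p =
  let c , 0<c , hc≡1 = reciprocal 0<h
      n , pc<n       = <fromℕ (p ℚ.* c)
      pch≡p          = trans (ℚₚ.*-assoc p c h)
        (trans (cong (p ℚ.*_) (trans (ℚₚ.*-comm c h) hc≡1)) (ℚₚ.*-identityʳ p))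
  in  n , subst₂ ℚ._<_ pch≡p (fromℕ-* n h) (*-posʳ-< 0<h pc<n)

^-pos : ∀ {p} → 0ℚ ℚ.< p → ∀ n → 0ℚ ℚ.< p ^ n
^-pos 0<p zero    = 0<1
^-pos 0<p (suc n) = *-pos 0<p (^-pos 0<p n)

^-monoˡ-≤ : ∀ {p q} → 0ℚ ℚ.< p → p ℚ.≤ q → ∀ n → p ^ n ℚ.≤ q ^ n
^-monoˡ-≤ 0<p p≤q zero    = ℚₚ.≤-refl
^-monoˡ-≤ 0<p p≤q (suc n) = ℚₚ.≤-trans (*-posʳ-≤ (^-pos 0<p n) p≤q)
  (*-posˡ-≤ (ℚₚ.<-≤-trans 0<p p≤q) (^-monoˡ-≤ 0<p p≤q n))

^-monoˡ-< : ∀ {p q} → 0ℚ ℚ.< p → p ℚ.< q → ∀ n → p ^ suc n ℚ.< q ^ suc n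
^-monoˡ-< 0<p p<q n = ℚₚ.<-≤-trans (*-posʳ-< (^-pos 0<p n) p<q)
  (*-posˡ-≤ (ℚₚ.<-trans 0<p p<q) (^-monoˡ-≤ 0<p (ℚₚ.<⇒≤ p<q) n))

1^n≡1 : ∀ n → 1ℚ ^ n ≡ 1ℚ
1^n≡1 zero    = refl
1^n≡1 (suc n) = trans (ℚₚ.*-identityˡ (1ℚ ^ n)) (1^n≡1 n)

1≤^ : ∀ {p} → 1ℚ ℚ.≤ p → ∀ n → 1ℚ ℚ.≤ p ^ n
1≤^ {p} 1≤p n = subst (ℚ._≤ p ^ n) (1^n≡1 n) (^-monoˡ-≤ 0<1 1≤p n)

^-monoʳ-≤ : ∀ {p} → 1ℚ ℚ.≤ p → ∀ {m n} → m ℕ.≤ n → p ^ m ℚ.≤ p ^ n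
^-monoʳ-≤ 1≤p {n = n} ℕ.z≤n = 1≤^ 1≤p n
^-monoʳ-≤ 1≤p (ℕ.s≤s m≤n)   = *-posˡ-≤ (ℚₚ.<-≤-trans 0<1 1≤p) (^-monoʳ-≤ 1≤p m≤n)

-- Bernoulli's inequality.
bernoulli : ∀ {h} → 0ℚ ℚ.< h → ∀ n → 1ℚ ℚ.+ n · h ℚ.≤ (1ℚ ℚ.+ h) ^ n
bernoulli {h} 0<h zero    = ℚₚ.≤-reflexive (ℚₚ.+-identityʳ 1ℚ)
bernoulli {h} 0<h (suc n) = subst₂ ℚ._≤_
  (trans (cong (a ℚ.+_) (ℚₚ.+-identityʳ h)) (trans (ℚₚ.+-assoc 1ℚ (n · h) h)
    (cong (1ℚ ℚ.+_) (ℚₚ.+-comm (n · h) h))))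
  (trans (cong (b ℚ.+_) (ℚₚ.*-comm h b)) (sym b+bh))
  (ℚₚ.+-mono-≤ (bernoulli 0<h n) h+0≤hb)
  where
  a b : ℚ
  a = 1ℚ ℚ.+ n · h
  b = (1ℚ ℚ.+ h) ^ n
  1≤1+h : 1ℚ ℚ.≤ 1ℚ ℚ.+ h
  1≤1+h = subst (ℚ._≤ 1ℚ ℚ.+ h) (ℚₚ.+-identityʳ 1ℚ) (ℚₚ.+-monoʳ-≤ 1ℚ (ℚₚ.<⇒≤ 0<h))
  h+0≤hb : h ℚ.+ 0ℚ ℚ.≤ h ℚ.* b
  h+0≤hb = subst (ℚ._≤ h ℚ.* b) (trans (ℚₚ.*-identityʳ h) (sym (ℚₚ.+-identityʳ h)))
    (*-posˡ-≤ 0<h (1≤^ 1≤1+h n))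
  b+bh : (1ℚ ℚ.+ h) ℚ.* b ≡ b ℚ.+ b ℚ.* h
  b+bh = trans (ℚₚ.*-distribʳ-+ b 1ℚ h) (cong₂ ℚ._+_ (ℚₚ.*-identityˡ b) (ℚₚ.*-comm h b))

[1+h]^-unbounded : ∀ {h} → 0ℚ ℚ.< h → ∀ p → ∃[ n ] p ℚ.< (1ℚ ℚ.+ h) ^ n
[1+h]^-unbounded {h} 0<h p =
  let n , p<nh = archimedean 0<h p
      nh≤1+nh  = subst (ℚ._≤ 1ℚ ℚ.+ n · h) (ℚₚ.+-identityˡ (n · h))
                   (ℚₚ.+-monoˡ-≤ (n · h) (ℚₚ.<⇒≤ 0<1))
  in  n , ℚₚ.<-≤-trans p<nh (ℚₚ.≤-trans nh≤1+nh (bernoulli 0<h n))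

p+[q-p]≡q : ∀ p q → p ℚ.+ (q ℚ.- p) ≡ q
p+[q-p]≡q = solve 2 (λ p q → p :+ (q :- p) := q) refl
  where open ℚSolver.+-*-Solver

^-unbounded : ∀ {t} → 1ℚ ℚ.< t → ∀ p → ∃[ n ] p ℚ.< t ^ n
^-unbounded {t} 1<t p = subst (λ z → ∃[ n ] p ℚ.< z ^ n) (p+[q-p]≡q 1ℚ t)
  ([1+h]^-unbounded (<⇒0<- 1<t) p)

------------------------------------------------------------------------
-- Real numbers as (two-sided, located) Dedekind cuts of ℚ

record ℝ : Set₁ where
  field
    Lower Upper : ℚ → Set
    inhabitedˡ  : ∃ Lower
    inhabitedᵘ  : ∃ Upper
    closedˡ     : ∀ {p q} → p ℚ.< q → Lower q → Lower p
    closedᵘ     : ∀ {p q} → p ℚ.< q → Upper p → Upper q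
    openˡ       : ∀ {p} → Lower p → ∃[ q ] p ℚ.< q × Lower q
    openᵘ       : ∀ {q} → Upper q → ∃[ p ] p ℚ.< q × Upper p
    disjoint    : ∀ {q} → Lower q → ¬ Upper q
    located     : ∀ {p q} → p ℚ.< q → Lower p ⊎ Upper q

open ℝ public

lower<upper : ∀ x {p q} → Lower x p → Upper x q → p ℚ.< q
lower<upper x {p} {q} Lp Uq with q ℚₚ.≤? p
... | no  q≰p = ℚₚ.≰⇒> q≰p
... | yes q≤p with openᵘ x Uq
...   | r , r<q , Ur = ⊥-elim (disjoint x Lp (closedᵘ x (ℚₚ.<-≤-trans r<q q≤p) Ur))

infix 4 _<ᴿ_ _≤ᴿ_ _≈ᴿ_

_<ᴿ_ : ℝ → ℝ → Set
x <ᴿ y = ∃[ q ] Upper x q × Lower y q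

_≤ᴿ_ : ℝ → ℝ → Set
x ≤ᴿ y = ¬ (y <ᴿ x)

_≈ᴿ_ : ℝ → ℝ → Set
x ≈ᴿ y = x ≤ᴿ y × y ≤ᴿ x

fromℚ : ℚ → ℝ
fromℚ r = record
  { Lower      = ℚ._< r
  ; Upper      = r ℚ.<_
  ; inhabitedˡ = r ℚ.- 1ℚ , subst (r ℚ.- 1ℚ ℚ.<_) (ℚₚ.+-identityʳ r)
                   (ℚₚ.+-monoʳ-< r (ℚₚ.neg-antimono-< 0<1))
  ; inhabitedᵘ = r ℚ.+ 1ℚ , subst (ℚ._< r ℚ.+ 1ℚ) (ℚₚ.+-identityʳ r)
                   (ℚₚ.+-monoʳ-< r 0<1)
  ; closedˡ    = ℚₚ.<-trans
  ; closedᵘ    = λ p<q r<p → ℚₚ.<-trans r<p p<q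
  ; openˡ      = ℚₚ.<-dense
  ; openᵘ      = λ r<q → let p , r<p , p<q = ℚₚ.<-dense r<q in p , p<q , r<p
  ; disjoint   = ℚₚ.<-asym
  ; located    = loc
  }
  where
  loc : ∀ {p q} → p ℚ.< q → p ℚ.< r ⊎ r ℚ.< q
  loc {p} p<q with p ℚₚ.<? r
  ... | yes p<r = inj₁ p<r
  ... | no  p≮r = inj₂ (ℚₚ.≤-<-trans (ℚₚ.≮⇒≥ p≮r) p<q)

fromℤ : ℤ → ℝ
fromℤ i = fromℚ (i / 1)

0ᴿ 1ᴿ : ℝ
0ᴿ = fromℚ 0ℚ
1ᴿ = fromℚ 1ℚ

approximate : ∀ x {ε} → 0ℚ ℚ.< ε → ∃[ p ] ∃[ q ] Lower x p × Upper x q × q ℚ.- p ℚ.< ε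
approximate x {ε} 0<ε with ℚₚ.<-dense 0<ε
... | ε₁ , 0<ε₁ , ε₁<ε = go₀
  where
  open ℚSolver.+-*-Solver
  h = ε₁ ℚ.* ℚ.½
  h+h≡ε₁ : h ℚ.+ h ≡ ε₁
  h+h≡ε₁ = trans (sym (ℚₚ.*-distribˡ-+ ε₁ ℚ.½ ℚ.½)) (ℚₚ.*-identityʳ ε₁)
  0<h : 0ℚ ℚ.< h
  0<h = *-pos 0<ε₁ (ℚ.*<* (ℤ.+<+ (ℕ.s≤s ℕ.z≤n)))
  grow : ∀ p → p ℚ.+ h ℚ.< p ℚ.+ h ℚ.+ h
  grow p = subst (ℚ._< p ℚ.+ h ℚ.+ h) (ℚₚ.+-identityʳ (p ℚ.+ h)) (ℚₚ.+-monoʳ-< (p ℚ.+ h) 0<h)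
  width : ∀ p → p ℚ.+ h ℚ.+ h ℚ.- p ℚ.< ε
  width p = subst (ℚ._< ε)
    (trans (sym h+h≡ε₁) (solve 2 (λ p h → h :+ h := p :+ h :+ h :- p) refl p h)) ε₁<ε
  go : ∀ n p → Lower x p → Upper x (p ℚ.+ n · h) →
       ∃[ p ] ∃[ q ] Lower x p × Upper x q × q ℚ.- p ℚ.< ε
  go zero p Lp U = ⊥-elim (disjoint x Lp (subst (Upper x) (ℚₚ.+-identityʳ p) U))
  go (suc n) p Lp U with located x (grow p)
  ... | inj₁ L₁ = go n (p ℚ.+ h) L₁ (subst (Upper x) (sym (ℚₚ.+-assoc p h (n · h))) U)
  ... | inj₂ U₁ = p , p ℚ.+ h ℚ.+ h , Lp , U₁ , width p
  go₀ : ∃[ p ] ∃[ q ] Lower x p × Upper x q × q ℚ.- p ℚ.< ε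
  go₀ = let p , Lp = inhabitedˡ x
            q , Uq = inhabitedᵘ x
            n , q-p<nh = archimedean 0<h (q ℚ.- p)
        in  go n p Lp (closedᵘ x (subst (ℚ._< p ℚ.+ n · h) (p+[q-p]≡q p q)
              (ℚₚ.+-monoʳ-< p q-p<nh)) Uq)

infixl 6 _+ᴿ_ _-ᴿ_
infix  8 -ᴿ_
infixr 7 _•_

_+ᴿ_ : ℝ → ℝ → ℝ
x +ᴿ y = record
  { Lower      = L
  ; Upper      = U
  ; inhabitedˡ = let a , La = inhabitedˡ x ; b , Lb = inhabitedˡ y
                     q , L  = inhabitedˡ (fromℚ (a ℚ.+ b))
                 in  q , a , b , La , Lb , L
  ; inhabitedᵘ = let a , Ua = inhabitedᵘ x ; b , Ub = inhabitedᵘ y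
                     q , U  = inhabitedᵘ (fromℚ (a ℚ.+ b))
                 in  q , a , b , Ua , Ub , U
  ; closedˡ    = λ p<q (a , b , La , Lb , q<) → a , b , La , Lb , ℚₚ.<-trans p<q q<
  ; closedᵘ    = λ p<q (a , b , Ua , Ub , <p) → a , b , Ua , Ub , ℚₚ.<-trans <p p<q
  ; openˡ      = λ (a , b , La , Lb , p<) → let q , p<q , q< = ℚₚ.<-dense p<
                 in q , p<q , a , b , La , Lb , q<
  ; openᵘ      = λ (a , b , Ua , Ub , <q) → let p , <p , p<q = ℚₚ.<-dense <q
                 in p , p<q , a , b , Ua , Ub , <p
  ; disjoint   = λ (a , b , La , Lb , q<) (c , d , Uc , Ud , <q) →
                 ℚₚ.<-asym (ℚₚ.<-trans <q q<)
                   (ℚₚ.+-mono-< (lower<upper x La Uc) (lower<upper y Lb Ud))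
  ; located    = loc
  }
  where
  open ℚSolver.+-*-Solver
  L U : ℚ → Set
  L q = ∃[ a ] ∃[ b ] Lower x a × Lower y b × q ℚ.< a ℚ.+ b
  U q = ∃[ a ] ∃[ b ] Upper x a × Upper y b × a ℚ.+ b ℚ.< q

  gap : ∀ a c p q → c ℚ.- a ℚ.< q ℚ.- p → p ℚ.- a ℚ.< q ℚ.- c
  gap a c p q c-a<q-p = subst₂ ℚ._<_
    (solve 3 (λ a c p → (c :- a) :+ (p :- c) := p :- a) refl a c p)
    (solve 3 (λ c p q → (q :- p) :+ (p :- c) := q :- c) refl c p q)
    (ℚₚ.+-monoˡ-< (p ℚ.- c) c-a<q-p)

  locˡ : ∀ a p → Lower x a → Lower y (p ℚ.- a) → L p
  locˡ a p La L₁ = let b , p-a<b , Lb = openˡ y L₁ in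
    a , b , La , Lb , subst (ℚ._< a ℚ.+ b) (p+[q-p]≡q a p) (ℚₚ.+-monoʳ-< a p-a<b)

  locᵘ : ∀ c q → Upper x c → Upper y (q ℚ.- c) → U q
  locᵘ c q Uc U₁ = let b , b<q-c , Ub = openᵘ y U₁ in
    c , b , Uc , Ub , subst (c ℚ.+ b ℚ.<_) (p+[q-p]≡q c q) (ℚₚ.+-monoʳ-< c b<q-c)

  loc : ∀ {p q} → p ℚ.< q → L p ⊎ U q
  loc {p} {q} p<q = let a , c , La , Uc , c-a<q-p = approximate x (<⇒0<- p<q) in
    Sum.map (locˡ a p La) (locᵘ c q Uc) (located y (gap a c p q c-a<q-p))

neg-involutive : ∀ q → ℚ.- (ℚ.- q) ≡ q
neg-involutive q = solve 1 (λ q → :- (:- q) := q) refl q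
  where open ℚSolver.+-*-Solver

-ᴿ_ : ℝ → ℝ
-ᴿ x = record
  { Lower      = λ q → Upper x (ℚ.- q)
  ; Upper      = λ q → Lower x (ℚ.- q)
  ; inhabitedˡ = let q , U = inhabitedᵘ x in ℚ.- q , subst (Upper x) (sym (neg-involutive q)) U
  ; inhabitedᵘ = let q , L = inhabitedˡ x in ℚ.- q , subst (Lower x) (sym (neg-involutive q)) L
  ; closedˡ    = λ p<q → closedᵘ x (ℚₚ.neg-antimono-< p<q)
  ; closedᵘ    = λ p<q → closedˡ x (ℚₚ.neg-antimono-< p<q)
  ; openˡ      = λ {p} U → let q , q<-p , Uq = openᵘ x U in
                 ℚ.- q , subst (ℚ._< ℚ.- q) (neg-involutive p) (ℚₚ.neg-antimono-< q<-p)
                       , subst (Upper x) (sym (neg-involutive q)) Uq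
  ; openᵘ      = λ {p} L → let q , -p<q , Lq = openˡ x L in
                 ℚ.- q , subst (ℚ.- q ℚ.<_) (neg-involutive p) (ℚₚ.neg-antimono-< -p<q)
                       , subst (Lower x) (sym (neg-involutive q)) Lq
  ; disjoint   = λ U L → disjoint x L U
  ; located    = λ p<q → Sum.swap (located x (ℚₚ.neg-antimono-< p<q))
  }

_-ᴿ_ : ℝ → ℝ → ℝ
x -ᴿ y = x +ᴿ (-ᴿ y)

_•_ : ℕ → ℝ → ℝ
zero  • x = 0ᴿ
suc n • x = x +ᴿ n • x

-- In the cuts below r * c ≡ 1 says c = 1/r.
inverse : ∀ x → 0ᴿ <ᴿ x → ℝ
inverse x (r₀ , 0<r₀ , Lr₀) = record
  { Lower      = L
  ; Upper      = U
  ; inhabitedˡ = let u , Uu = inhabitedᵘ x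
                     c , 0<c , uc≡1 = reciprocal (upper>0 Uu)
                 in  0ℚ , u , c , Uu , uc≡1 , 0<c
  ; inhabitedᵘ = let c , 0<c , rc≡1 = reciprocal 0<r₀
                     q , c<q = inhabitedᵘ (fromℚ c)
                 in  q , r₀ , c , 0<r₀ , Lr₀ , rc≡1 , c<q
  ; closedˡ    = λ p<q (r , c , Ur , e , q<c) → r , c , Ur , e , ℚₚ.<-trans p<q q<c
  ; closedᵘ    = λ p<q (r , c , 0<r , Lr , e , c<p) → r , c , 0<r , Lr , e , ℚₚ.<-trans c<p p<q
  ; openˡ      = λ (r , c , Ur , e , p<c) → let q , p<q , q<c = ℚₚ.<-dense p<c
                 in q , p<q , r , c , Ur , e , q<c
  ; openᵘ      = λ (r , c , 0<r , Lr , e , c<q) → let p , c<p , p<q = ℚₚ.<-dense c<q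
                 in p , p<q , r , c , 0<r , Lr , e , c<p
  ; disjoint   = disj
  ; located    = λ {p} p<q → loc (0ℚ ℚₚ.<? p) p<q
  }
  where
  L U : ℚ → Set
  L q = ∃[ r ] ∃[ c ] Upper x r × r ℚ.* c ≡ 1ℚ × q ℚ.< c
  U q = ∃[ r ] ∃[ c ] 0ℚ ℚ.< r × Lower x r × r ℚ.* c ≡ 1ℚ × c ℚ.< q

  upper>0 : ∀ {r} → Upper x r → 0ℚ ℚ.< r
  upper>0 Ur = ℚₚ.<-trans 0<r₀ (lower<upper x Lr₀ Ur)

  disj : ∀ {q} → L q → ¬ U q
  disj (r , c , Ur , rc≡1 , q<c) (r′ , c′ , 0<r′ , Lr′ , r′c′≡1 , c′<q) =
    ℚₚ.<-asym (ℚₚ.<-trans c′<q q<c)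
      (reciprocal-anti-< 0<r′ (reciprocal-pos (upper>0 Ur) rc≡1) r′c′≡1 rc≡1
        (lower<upper x Lr′ Ur))

  loc⁺ : ∀ {p q} → 0ℚ ℚ.< p → p ℚ.< q → L p ⊎ U q
  loc⁺ {p} {q} 0<p p<q =
    let p₁ , p<p₁ , p₁<q = ℚₚ.<-dense p<q
        q₁ , p₁<q₁ , q₁<q = ℚₚ.<-dense p₁<q
        0<p₁ = ℚₚ.<-trans 0<p p<p₁
        b , 0<b , p₁b≡1 = reciprocal 0<p₁
        a , 0<a , q₁a≡1 = reciprocal (ℚₚ.<-trans 0<p₁ p₁<q₁)
    in  Sum.swap (Sum.map
          (λ La → a , q₁ , 0<a , La , trans (ℚₚ.*-comm a q₁) q₁a≡1 , q₁<q)
          (λ Ub → b , p₁ , Ub , trans (ℚₚ.*-comm b p₁) p₁b≡1 , p<p₁)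
          (located x (reciprocal-anti-< 0<p₁ 0<a p₁b≡1 q₁a≡1 p₁<q₁)))

  loc : ∀ {p q} → Dec (0ℚ ℚ.< p) → p ℚ.< q → L p ⊎ U q
  loc (yes 0<p) p<q = loc⁺ 0<p p<q
  loc (no  0≮p) p<q =
    let u , Uu = inhabitedᵘ x
        c , 0<c , uc≡1 = reciprocal (upper>0 Uu)
    in  inj₁ (u , c , Uu , uc≡1 , ℚₚ.≤-<-trans (ℚₚ.≮⇒≥ 0≮p) 0<c)

------------------------------------------------------------------------
-- Real powers d ^ (- s) of a positive integer d

ratio : ℕ → ℕ → ℕ → ℚ
ratio m n b = (m ⊖ n) / suc b

ratio-surjective : ∀ r → ∃[ m ] ∃[ n ] ∃[ b ] r ≡ ratio m n b
ratio-surjective r@(ℚ.mkℚ (+ m)    b _) = m , 0     , b , sym (ℚₚ.↥p/↧p≡p r)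
ratio-surjective r@(ℚ.mkℚ -[1+ n ] b _) = 0 , suc n , b , sym (ℚₚ.↥p/↧p≡p r)

ratio-<-suc : ∀ m n b → ratio m n b ℚ.< ratio (suc m) n b
ratio-<-suc m n b = ℚₚ.toℚᵘ-cancel-<
  (ℚᵘₚ.<-respˡ-≃ (ℚᵘₚ.≃-sym (ℚₚ.toℚᵘ-fromℚᵘ (ℚᵘ.mkℚᵘ (m ⊖ n) b)))
  (ℚᵘₚ.<-respʳ-≃ (ℚᵘₚ.≃-sym (ℚₚ.toℚᵘ-fromℚᵘ (ℚᵘ.mkℚᵘ (suc m ⊖ n) b)))
    (ℚᵘ.*<* (ℤₚ.*-monoʳ-<-pos (+ suc b) (ℤₚ.⊖-monoˡ-< n (ℕₚ.n<1+n m))))))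

ratio-<⇒< : ∀ m n b m′ n′ b′ → ratio m n b ℚ.< ratio m′ n′ b′ →
  m ℕ.* suc b′ ℕ.+ n′ ℕ.* suc b ℕ.< m′ ℕ.* suc b ℕ.+ n ℕ.* suc b′
ratio-<⇒< m n b m′ n′ b′ lt = ℤₚ.drop‿+<+ (subst₂ ℤ._<_ left right (ℤₚ.+-monoˡ-< k lt′))
  where
  open ℤSolver.+-*-Solver
  k = + n ℤ.* + suc b′ ℤ.+ + n′ ℤ.* + suc b
  hom : ∀ u v w z → + u ℤ.* + v ℤ.+ + w ℤ.* + z ≡ + (u ℕ.* v ℕ.+ w ℕ.* z)
  hom u v w z = trans (cong₂ ℤ._+_ (sym (ℤₚ.pos-* u v)) (sym (ℤₚ.pos-* w z)))
    (sym (ℤₚ.pos-+ (u ℕ.* v) (w ℕ.* z)))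
  lt′ : (m ⊖ n) ℤ.* + suc b′ ℤ.< (m′ ⊖ n′) ℤ.* + suc b
  lt′ = ℚᵘₚ.drop-*<*
    (ℚᵘₚ.<-respˡ-≃ (ℚₚ.toℚᵘ-fromℚᵘ (ℚᵘ.mkℚᵘ (m ⊖ n) b))
    (ℚᵘₚ.<-respʳ-≃ (ℚₚ.toℚᵘ-fromℚᵘ (ℚᵘ.mkℚᵘ (m′ ⊖ n′) b′)) (ℚₚ.toℚᵘ-mono-< lt)))
  left : (m ⊖ n) ℤ.* + suc b′ ℤ.+ k ≡ + (m ℕ.* suc b′ ℕ.+ n′ ℕ.* suc b)
  left = trans (cong (λ z → z ℤ.* + suc b′ ℤ.+ k) (sym (ℤₚ.m-n≡m⊖n m n)))
    (trans (solve 5 (λ m n b n′ b′ → (m :- n) :* b′ :+ (n :* b′ :+ n′ :* b) := m :* b′ :+ n′ :* b)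
      refl (+ m) (+ n) (+ suc b) (+ n′) (+ suc b′)) (hom m (suc b′) n′ (suc b)))
  right : (m′ ⊖ n′) ℤ.* + suc b ℤ.+ k ≡ + (m′ ℕ.* suc b ℕ.+ n ℕ.* suc b′)
  right = trans (cong (λ z → z ℤ.* + suc b ℤ.+ k) (sym (ℤₚ.m-n≡m⊖n m′ n′)))
    (trans (solve 5 (λ m′ n b n′ b′ → (m′ :- n′) :* b :+ (n :* b′ :+ n′ :* b) := m′ :* b :+ n :* b′)
      refl (+ m′) (+ n) (+ suc b) (+ n′) (+ suc b′)) (hom m′ (suc b) n (suc b′)))

crossing : ∀ (f : ℕ → ℚ) c → f 0 ℚ.≤ c → ∀ N → c ℚ.< f N →
           ∃[ m ] f m ℚ.≤ c × c ℚ.< f (suc m)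
crossing f c f0≤c zero    c<f0 = ⊥-elim (ℚₚ.<-irrefl refl (ℚₚ.<-≤-trans c<f0 f0≤c))
crossing f c f0≤c (suc N) c<fN+1 = go (f N ℚₚ.≤? c)
  where
  go : Dec (f N ℚ.≤ c) → ∃[ m ] f m ℚ.≤ c × c ℚ.< f (suc m)
  go (yes fN≤c) = N , fN≤c , c<fN+1
  go (no  fN≰c) = crossing f c f0≤c N (ℚₚ.≰⇒> fN≰c)

-- For 0 < p < q and D > 1 some power D^-(m-n)/b separates p and q,
-- with room for one more step in m.
separate : ∀ {D p q} → 1ℚ ℚ.< D → 0ℚ ℚ.< p → p ℚ.< q →
  ∃[ m ] ∃[ n ] ∃[ b ] D ^ n ℚ.< q ^ suc b ℚ.* D ^ m × p ^ suc b ℚ.* D ^ suc m ℚ.< D ^ n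
separate {D} {p} {q} 1<D 0<p p<q =
  let c , 0<c , pc≡1  = reciprocal 0<p
      t               = q ℚ.* c
      q≡pt            = trans (sym (ℚₚ.*-identityʳ q)) (trans (cong (q ℚ.*_) (sym pc≡1)) (x[yz]≡y[xz] q p c))
      1<t             = subst (ℚ._< t) pc≡1 (*-posʳ-< 0<c p<q)
      b , DD<t^b      = ^-unbounded 1<t (D ℚ.* D)
      DD<t^1+b        = ℚₚ.<-≤-trans DD<t^b (^-monoʳ-≤ (ℚₚ.<⇒≤ 1<t) (ℕₚ.n≤1+n b))
      x               = q ^ suc b
      x≡p^t^          = trans (cong (_^ suc b) q≡pt) (^-distrib-* p t (suc b))
      0<x             = ^-pos (ℚₚ.<-trans 0<p p<q) (suc b)
      n , x<D^n       = ^-unbounded 1<D x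
      y , 0<y , xy≡1  = reciprocal 0<x
      N , D^ny<D^N    = ^-unbounded 1<D (D ^ n ℚ.* y)
      D^n<xD^N        = subst (ℚ._< x ℚ.* D ^ N) (cancel x y (D ^ n) xy≡1) (*-posˡ-< 0<x D^ny<D^N)
      m , ≤D^n , D^n< = crossing (λ k → x ℚ.* D ^ k) (D ^ n)
                          (ℚₚ.<⇒≤ (subst (ℚ._< D ^ n) (sym (ℚₚ.*-identityʳ x)) x<D^n)) N D^n<xD^N
      P               = p ^ suc b
      0<P             = ^-pos 0<p (suc b)
  in  suc m , n , b , D^n<
    , ℚₚ.<-≤-trans
        (subst₂ ℚ._<_ (regroup P D (D ^ m))
          (trans (sym (ℚₚ.*-assoc P (t ^ suc b) (D ^ m))) (cong (ℚ._* D ^ m) (sym x≡p^t^)))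
          (*-posˡ-< 0<P (*-posʳ-< (^-pos 0<D m) DD<t^1+b)))
        ≤D^n
  where
  open ℚSolver.+-*-Solver
  0<D = ℚₚ.<-trans 0<1 1<D
  x[yz]≡y[xz] : ∀ x y z → x ℚ.* (y ℚ.* z) ≡ y ℚ.* (x ℚ.* z)
  x[yz]≡y[xz] = solve 3 (λ x y z → x :* (y :* z) := y :* (x :* z)) refl
  regroup : ∀ x d e → x ℚ.* (d ℚ.* d ℚ.* e) ≡ x ℚ.* (d ℚ.* (d ℚ.* e))
  regroup x d e = cong (x ℚ.*_) (ℚₚ.*-assoc d d e)
  cancel : ∀ x y z → x ℚ.* y ≡ 1ℚ → x ℚ.* (z ℚ.* y) ≡ z
  cancel x y z xy≡1 = trans (x[yz]≡y[xz] x z y) (trans (cong (z ℚ.*_) xy≡1) (ℚₚ.*-identityʳ z))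

1≤fromℕ : ∀ {d} → 0 ℕ.< d → 1ℚ ℚ.≤ fromℕ d
1≤fromℕ {suc d} _ = subst₂ ℚ._≤_ (ℚₚ.+-identityʳ 1ℚ) (sym (fromℕ-suc d))
  (ℚₚ.+-monoʳ-≤ 1ℚ (ℚₚ.nonNegative⁻¹ (fromℕ d) {{ℚₚ.normalize-nonNeg d 1}}))

infixr 8 _^-_

-- The cut of rational powers: for r = (m - n)/b and p > 0,
--   p < d^(-r)  iff  p^b * d^m < d^n,
-- and d^(-s) is the supremum (infimum) of d^(-r) over rationals r > s (r < s).
_^-_ : (d : ℕ) .{{_ : ℕ.NonZero d}} → ℝ → ℝ
d ^- s = record
  { Lower      = L
  ; Upper      = U
  ; inhabitedˡ = inhabˡ
  ; inhabitedᵘ = inhabᵘ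
  ; closedˡ    = λ p<q (p₁ , m , n , b , q<p₁ , Us , h) →
                   p₁ , m , n , b , ℚₚ.<-trans p<q q<p₁ , Us , h
  ; closedᵘ    = λ p<q (p₁ , m , n , b , p₁<p , Ls , h) →
                   p₁ , m , n , b , ℚₚ.<-trans p₁<p p<q , Ls , h
  ; openˡ      = λ (p₁ , m , n , b , p<p₁ , Us , h) → let q , p<q , q<p₁ = ℚₚ.<-dense p<p₁
                   in q , p<q , p₁ , m , n , b , q<p₁ , Us , h
  ; openᵘ      = λ (p₁ , m , n , b , p₁<q , Ls , h) → let p , p₁<p , p<q = ℚₚ.<-dense p₁<q
                   in p , p<q , p₁ , m , n , b , p₁<p , Ls , h
  ; disjoint   = disj
  ; located    = λ {p} → loc (1ℚ ℚₚ.<? D) (0ℚ ℚₚ.≤? p)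
  }
  where
  D : ℚ
  D = fromℕ d
  1≤D : 1ℚ ℚ.≤ D
  1≤D = 1≤fromℕ (ℕ.>-nonZero⁻¹ d)
  0<D : 0ℚ ℚ.< D
  0<D = ℚₚ.<-≤-trans 0<1 1≤D

  L U : ℚ → Set
  L q = ∃[ p ] ∃[ m ] ∃[ n ] ∃[ b ] q ℚ.< p × Upper s (ratio m n b) ×
          (0ℚ ℚ.< p → p ^ suc b ℚ.* D ^ m ℚ.< D ^ n)
  U q = ∃[ p ] ∃[ m ] ∃[ n ] ∃[ b ] p ℚ.< q × Lower s (ratio m n b) ×
          0ℚ ℚ.< p × D ^ n ℚ.< p ^ suc b ℚ.* D ^ m

  ratioᵘ : ∃[ m ] ∃[ n ] ∃[ b ] Upper s (ratio m n b)
  ratioᵘ = let r , Ur = inhabitedᵘ s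
               m , n , b , e = ratio-surjective r
           in  m , n , b , subst (Upper s) e Ur

  ratioˡ : ∃[ m ] ∃[ n ] ∃[ b ] Lower s (ratio m n b)
  ratioˡ = let r , Lr = inhabitedˡ s
               m , n , b , e = ratio-surjective r
           in  m , n , b , subst (Lower s) e Lr

  L-neg : ∀ {q} → q ℚ.< 0ℚ → L q
  L-neg q<0 = let m , n , b , Us = ratioᵘ in
    0ℚ , m , n , b , q<0 , Us , λ 0<0 → ⊥-elim (ℚₚ.<-irrefl refl 0<0)

  inhabˡ : ∃ L
  inhabˡ = let q , q<0 = inhabitedˡ 0ᴿ in q , L-neg q<0

  inhabᵘ : ∃ U
  inhabᵘ =
    let m , n , b , Ls = ratioˡ
        E      = D ^ n
        p      = 1ℚ ℚ.+ E
        1<p    = subst (ℚ._< p) (ℚₚ.+-identityʳ 1ℚ) (ℚₚ.+-monoʳ-< 1ℚ (^-pos 0<D n))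
        0<p    = ℚₚ.<-trans 0<1 1<p
        E<p    = subst (ℚ._< p) (ℚₚ.+-identityˡ E) (ℚₚ.+-monoˡ-< E 0<1)
        p≤p^b  = subst (ℚ._≤ p ^ suc b) (ℚₚ.*-identityʳ p) (*-posˡ-≤ 0<p (1≤^ (ℚₚ.<⇒≤ 1<p) b))
        P      = p ^ suc b
        P≤PD^m = subst (ℚ._≤ P ℚ.* D ^ m) (ℚₚ.*-identityʳ P)
                   (*-posˡ-≤ (^-pos 0<p (suc b)) (1≤^ 1≤D m))
        q , p<q = inhabitedᵘ (fromℚ p)
    in  q , p , m , n , b , p<q , Ls , 0<p , ℚₚ.<-≤-trans E<p (ℚₚ.≤-trans p≤p^b P≤PD^m)

  disj : ∀ {q} → L q → ¬ U q
  disj {q} (p , m , n , b , q<p , Us , h) (p′ , m′ , n′ , b′ , p′<q , Ls , 0<p′ , h′) =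
    ℚₚ.<-irrefl refl (ℚₚ.<-≤-trans (ℚₚ.<-trans step₁ step₂) (ℚₚ.≤-trans
      (*-posʳ-≤ (^-pos 0<D (m′ ℕ.* B ℕ.+ n ℕ.* B′)) p′^≤p^)
      (*-posˡ-≤ (^-pos 0<p (B ℕ.* B′)) D^≤)))
    where
    B B′ : ℕ
    B  = suc b
    B′ = suc b′
    p′<p = ℚₚ.<-trans p′<q q<p
    0<p  = ℚₚ.<-trans 0<p′ p′<p
    p′^≤p^ : p′ ^ (B ℕ.* B′) ℚ.≤ p ^ (B ℕ.* B′)
    p′^≤p^ = ^-monoˡ-≤ 0<p′ (ℚₚ.<⇒≤ p′<p) (B ℕ.* B′)
    D^≤ : D ^ (m′ ℕ.* B ℕ.+ n ℕ.* B′) ℚ.≤ D ^ (m ℕ.* B′ ℕ.+ n′ ℕ.* B)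
    D^≤ = ^-monoʳ-≤ 1≤D (ℕₚ.<⇒≤ (ratio-<⇒< m′ n′ b′ m n b (lower<upper s Ls Us)))
    P P′ : ℚ
    P  = p ^ (B ℕ.* B′)
    P′ = p′ ^ (B ℕ.* B′)
    raise : ∀ x u v k → (x ^ u ℚ.* D ^ v) ^ k ≡ x ^ (u ℕ.* k) ℚ.* D ^ (v ℕ.* k)
    raise x u v k = trans (^-distrib-* (x ^ u) (D ^ v) k) (cong₂ ℚ._*_ (^-assocʳ x u k) (^-assocʳ D v k))
    lower : P ℚ.* D ^ (m ℕ.* B′) ℚ.< D ^ (n ℕ.* B′)
    lower = subst₂ ℚ._<_ (raise p B m B′) (^-assocʳ D n B′)
      (^-monoˡ-< (*-pos (^-pos 0<p B) (^-pos 0<D m)) (h 0<p) b′)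
    upper : D ^ (n′ ℕ.* B) ℚ.< P′ ℚ.* D ^ (m′ ℕ.* B)
    upper = subst₂ ℚ._<_ (^-assocʳ D n′ B)
      (trans (raise p′ B′ m′ B) (cong (λ k → p′ ^ k ℚ.* D ^ (m′ ℕ.* B)) (ℕₚ.*-comm B′ B)))
      (^-monoˡ-< (^-pos 0<D n′) h′ b)
    -- P D^(m B′ + n′ B) < D^(n B′ + n′ B) < P′ D^(m′ B + n B′)
    step₁ : P ℚ.* D ^ (m ℕ.* B′ ℕ.+ n′ ℕ.* B) ℚ.< D ^ (n ℕ.* B′) ℚ.* D ^ (n′ ℕ.* B)
    step₁ = subst (ℚ._< D ^ (n ℕ.* B′) ℚ.* D ^ (n′ ℕ.* B))
      (trans (ℚₚ.*-assoc P (D ^ (m ℕ.* B′)) (D ^ (n′ ℕ.* B)))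
        (cong (P ℚ.*_) (sym (^-homo-* D (m ℕ.* B′) (n′ ℕ.* B)))))
      (*-posʳ-< (^-pos 0<D (n′ ℕ.* B)) lower)
    step₂ : D ^ (n ℕ.* B′) ℚ.* D ^ (n′ ℕ.* B) ℚ.< P′ ℚ.* D ^ (m′ ℕ.* B ℕ.+ n ℕ.* B′)
    step₂ = subst₂ ℚ._<_ (ℚₚ.*-comm (D ^ (n′ ℕ.* B)) (D ^ (n ℕ.* B′)))
      (trans (ℚₚ.*-assoc P′ (D ^ (m′ ℕ.* B)) (D ^ (n ℕ.* B′)))
        (cong (P′ ℚ.*_) (sym (^-homo-* D (m′ ℕ.* B) (n ℕ.* B′)))))
      (*-posʳ-< (^-pos 0<D (n ℕ.* B′)) upper)

  loc : ∀ {p q} → Dec (1ℚ ℚ.< D) → Dec (0ℚ ℚ.≤ p) → p ℚ.< q → L p ⊎ U q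
  loc {p} {q} _ (no 0≰p) _ = inj₁ (L-neg (ℚₚ.≰⇒> 0≰p))
  loc {p} {q} (yes 1<D) (yes 0≤p) p<q =
    let p₁ , p<p₁ , p₁<q = ℚₚ.<-dense p<q
        q₁ , p₁<q₁ , q₁<q = ℚₚ.<-dense p₁<q
        0<p₁ = ℚₚ.≤-<-trans 0≤p p<p₁
        m , n , b , above , below = separate 1<D 0<p₁ p₁<q₁
    in  Sum.swap (Sum.map
          (λ Ls → q₁ , m , n , b , q₁<q , Ls , ℚₚ.<-trans 0<p₁ p₁<q₁ , above)
          (λ Us → p₁ , suc m , n , b , p<p₁ , Us , λ _ → below)
          (located s (ratio-<-suc m n b)))
  loc {p} {q} (no 1≮D) (yes 0≤p) p<q =
    let p₁ , p<p₁ , p₁<q = ℚₚ.<-dense p<q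
    in  at-1 p₁ p<p₁ p₁<q (1ℚ ℚₚ.≤? p₁)
    where
    D^≡1 : ∀ n → D ^ n ≡ 1ℚ
    D^≡1 n = trans (cong (_^ n) (ℚₚ.≤-antisym (ℚₚ.≮⇒≥ 1≮D) 1≤D)) (1^n≡1 n)
    *D^ : ∀ x n → x ℚ.* D ^ n ≡ x
    *D^ x n = trans (cong (x ℚ.*_) (D^≡1 n)) (ℚₚ.*-identityʳ x)
    at-1 : ∀ p₁ → p ℚ.< p₁ → p₁ ℚ.< q → Dec (1ℚ ℚ.≤ p₁) → L p ⊎ U q
    at-1 p₁ p<p₁ p₁<q (yes 1≤p₁) =
      let m , n , b , Ls = ratioˡ
          q₁ , p₁<q₁ , q₁<q = ℚₚ.<-dense p₁<q
          1<q₁ = ℚₚ.≤-<-trans 1≤p₁ p₁<q₁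
      in  inj₂ (q₁ , m , n , b , q₁<q , Ls , ℚₚ.<-trans 0<1 1<q₁ ,
            subst₂ ℚ._<_ (trans (1^n≡1 (suc b)) (sym (D^≡1 n))) (sym (*D^ (q₁ ^ suc b) m))
              (^-monoˡ-< 0<1 1<q₁ b))
    at-1 p₁ p<p₁ p₁<q (no 1≰p₁) =
      let m , n , b , Us = ratioᵘ
      in  inj₁ (p₁ , m , n , b , p<p₁ , Us , λ 0<p₁ →
            subst₂ ℚ._<_ (sym (*D^ (p₁ ^ suc b) m)) (trans (1^n≡1 (suc b)) (sym (D^≡1 n)))
              (^-monoˡ-< 0<p₁ (ℚₚ.≰⇒> 1≰p₁) b))

------------------------------------------------------------------------
-- Extended non-negative reals and infima

data [0,∞] : Set₁ where
  fin : (a : ℝ) → 0ᴿ ≤ᴿ a → [0,∞]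
  ∞   : [0,∞]

infix 4 _≤∞_

_≤∞_ : [0,∞] → [0,∞] → Set
fin a _ ≤∞ fin b _ = a ≤ᴿ b
∞       ≤∞ fin _ _ = ⊥
_       ≤∞ ∞       = ⊤

-- Greatest lower bound in [0,∞] of { s ≥ 0 : S s }; it is ∞ when the set is empty.
IsInfimum : ∀ {ℓ} → (ℝ → Set ℓ) → [0,∞] → Set _
IsInfimum S α = IsLowerBound α × (∀ β → IsLowerBound β → β ≤∞ α)
  where
  IsLowerBound : [0,∞] → Set _
  IsLowerBound β = ∀ s (0≤s : 0ᴿ ≤ᴿ s) → S s → β ≤∞ fin s 0≤s

------------------------------------------------------------------------
-- Engel expansions

IsCeiling : ℝ → ℤ → Set
IsCeiling y n = y ≤ᴿ fromℤ n × (∀ m → y ≤ᴿ fromℤ m → n ℤ.≤ m)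

-- Functions of a real argument defined by case distinction or rounding (the
-- ceiling, the Engel map, the digits) and the exponent of convergence are given
-- by their graphs, since they are not constructively definable as functions.

-- d = ⌈ 1/x ⌉, for x > 0.
IsFirstDigit : ℝ → ℕ → Set
IsFirstDigit x d = Σ[ 0<x ∈ 0ᴿ <ᴿ x ] IsCeiling (inverse x 0<x) (+ d)

-- The graph of the Engel map T on [0,1).
data _T↦_ (x y : ℝ) : Set where
  at-zero  : x ≈ᴿ 0ᴿ → y ≈ᴿ 0ᴿ → x T↦ y
  positive : ∀ d → IsFirstDigit x d → y ≈ᴿ d • x -ᴿ 1ᴿ → x T↦ y

ℕ⁺ : Set
ℕ⁺ = Σ[ d ∈ ℕ ] ℕ.NonZero d

IsDigitAt : ℝ → Maybe ℕ⁺ → Set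
IsDigitAt x (just (d , _)) = IsFirstDigit x d
IsDigitAt x nothing        = x ≈ᴿ 0ᴿ

-- Here orbit n is Tⁿ(x) and digit n is dₙ₊₁(x), which is absent when Tⁿ(x) = 0.
record EngelExpansion (x : ℝ) : Set₁ where
  field
    orbit      : ℕ → ℝ
    orbit-zero : orbit 0 ≈ᴿ x
    orbit-suc  : ∀ n → orbit n T↦ orbit (suc n)
    digit      : ℕ → Maybe ℕ⁺
    digit-at   : ∀ n → IsDigitAt (orbit n) (digit n)

term : Maybe ℕ⁺ → ℝ → ℝ
term (just (d , d≢0)) s = _^-_ d {{d≢0}} s
term nothing          s = 0ᴿ

partialSum : (ℕ → Maybe ℕ⁺) → ℝ → ℕ → ℝ
partialSum d s zero    = 0ᴿ
partialSum d s (suc N) = partialSum d s N +ᴿ term (d N) s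

-- A series of non-negative terms has a finite sum when its partial sums are bounded.
FiniteSum : (ℕ → Maybe ℕ⁺) → ℝ → Set₁
FiniteSum d s = Σ[ B ∈ ℝ ] (∀ N → partialSum d s N ≤ᴿ B)

-- λ(x) = α.
HasExponent : ℝ → [0,∞] → Set₁
HasExponent x α = Σ[ e ∈ EngelExpansion x ] IsInfimum (FiniteSum (EngelExpansion.digit e)) α

LevelSet : [0,∞] → ℝ → Set₁
LevelSet α x = 0ᴿ <ᴿ x × x <ᴿ 1ᴿ × HasExponent x α

------------------------------------------------------------------------
-- Uncountable and dense sets of reals

-- A set is countable (possibly finite or empty) when some sequence covers it.
Countable : (ℝ → Set₁) → Set₁
Countable P = Σ[ f ∈ (ℕ → ℝ) ] (∀ x → P x → ∃[ n ] f n ≈ᴿ x)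

Uncountable : (ℝ → Set₁) → Set₁
Uncountable P = ¬ Countable P

-- Every open interval around a point of (0,1) meets P.
DenseIn01 : (ℝ → Set₁) → Set₁
DenseIn01 P = ∀ y → 0ᴿ <ᴿ y → y <ᴿ 1ᴿ → ∀ a b → a <ᴿ y → y <ᴿ b →
              Σ[ x ∈ ℝ ] (P x × a <ᴿ x × x <ᴿ b)

-- Digits are chosen in blocks: level k consists of 2 ^ M k or 2 ^ M k + 1 copies of
-- 2 ^ e with e = (k + 1)(k + 3), where M k differs from e a by at most 1 (for α = a) or
-- is e k (for α = ∞).  Level k contributes about 2 ^ (e (a - s)) to the sum of the
-- d ^ (- s), so the sum converges for s > a and diverges for s < a.  A finite prefix of
-- the digits has no influence on this, and prefixing the Engel expansion of a rational
-- u puts the point just above u, whence density.  The free choice of the length of each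
-- block allows the k-th block to avoid the k-th member of a given sequence of reals,
-- whence uncountability.

module Submission where

open import Defs
open import Data.Nat.Base as ℕ using (ℕ; zero; suc)
import Data.Nat.Properties as ℕₚ
open import Data.Nat.Coprimality using (Coprime)
open import Data.Nat.DivMod using (m≡m%n+[m/n]*n; m%n<n; /-monoʳ-≤; m≥n⇒m/n>0)
open import Data.Nat.Induction using (<-rec)
import Data.Nat.Solver as ℕSolver
open import Data.Integer.Base as ℤ using (ℤ; +_; -[1+_])
import Data.Integer.Properties as ℤₚ
open import Data.Maybe.Base using (Maybe; just)
open import Data.Rational.Base as ℚ using (ℚ; 0ℚ; 1ℚ; ½)
import Data.Rational.Properties as ℚₚ
import Data.Rational.Solver as ℚSolver
import Data.Rational.Unnormalised.Base as ℚᵘ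
import Data.Rational.Unnormalised.Properties as ℚᵘₚ
open import Data.Product.Base using (∃; ∃-syntax; Σ-syntax; _×_; _,_; proj₁; proj₂)
open import Data.Sum.Base as Sum using (_⊎_; inj₁; inj₂)
open import Data.Empty using (⊥-elim)
open import Function.Base using (case_of_)
open import Algebra.Bundles using (CommutativeRing)
open import Relation.Nullary.Negation.Core using (¬_)
open import Relation.Nullary.Decidable.Core using (Dec; yes; no)
open import Relation.Binary.PropositionalEquality
  using (_≡_; refl; sym; trans; cong; cong₂; subst; subst₂; module ≡-Reasoning)

open import Algebra.Definitions.RawSemiring ℚ.+-*-rawSemiring using (_^_)
open import Algebra.Properties.Semiring.Exp
  (CommutativeRing.semiring ℚₚ.+-*-commutativeRing) using (^-homo-*; ^-assocʳ)
open import Algebra.Properties.CommutativeSemiring.Exp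
  (CommutativeRing.commutativeSemiring ℚₚ.+-*-commutativeRing) using (^-distrib-*)

open ℕSolver.+-*-Solver using ()
  renaming (solve to ℕ-solve; _:=_ to _⊜_; _:+_ to _⊕_; _:*_ to _⊛_; con to κ)
open ℚSolver.+-*-Solver using (solve; _:=_; _:+_; _:*_; _:-_; con)

-- An exponent `a` is critical when there are about `D ^ a` digits of size `D`. Digits that are
-- powers of two turn each comparison of `d ^- s` with a bound into a linear inequality between
-- natural numbers, once rationals with denominators `B` and `B′` have been put between `s` and `a`.
-- Such rationals may differ by as little as 1/(B B′), while the contribution of level k has to
-- decay like 2^(-k); so `e` must outgrow every constant multiple of k, whence its quadratic growth.
-- As reals are cuts, neither the floor of e a nor a comparison of two reals is computable.
-- Locatedness offers only overlapping alternatives: this is why `M k` is known only up to 1, and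
-- why avoiding a given real takes two options with a gap between them. One optional digit per block
-- opens such a gap and at most doubles the contribution of the block.

-- Rational arithmetic

2ℚ : ℚ
2ℚ = 1ℚ ℚ.+ 1ℚ

0<½ : 0ℚ ℚ.< ½
0<½ = ℚ.*<* (ℤ.+<+ (ℕ.s≤s ℕ.z≤n))

1<2 : 1ℚ ℚ.< 2ℚ
1<2 = ℚ.*<* (ℤ.+<+ (ℕ.s≤s (ℕ.s≤s ℕ.z≤n)))

0<2 : 0ℚ ℚ.< 2ℚ
0<2 = ℚₚ.<-trans 0<1 1<2

½<1 : ½ ℚ.< 1ℚ
½<1 = ℚ.*<* (ℤ.+<+ (ℕ.s≤s (ℕ.s≤s ℕ.z≤n)))

p<p+q : ∀ p {q} → 0ℚ ℚ.< q → p ℚ.< p ℚ.+ q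
p<p+q p {q} 0<q = subst (ℚ._< p ℚ.+ q) (ℚₚ.+-identityʳ p) (ℚₚ.+-monoʳ-< p 0<q)

p≤p+q : ∀ p {q} → 0ℚ ℚ.≤ q → p ℚ.≤ p ℚ.+ q
p≤p+q p {q} 0≤q = subst (ℚ._≤ p ℚ.+ q) (ℚₚ.+-identityʳ p) (ℚₚ.+-monoʳ-≤ p 0≤q)

fromℕ-+ : ∀ m n → fromℕ (m ℕ.+ n) ≡ fromℕ m ℚ.+ fromℕ n
fromℕ-+ zero    n = sym (ℚₚ.+-identityˡ (fromℕ n))
fromℕ-+ (suc m) n = trans (fromℕ-suc (m ℕ.+ n))
  (trans (cong (1ℚ ℚ.+_) (fromℕ-+ m n))
  (trans (sym (ℚₚ.+-assoc 1ℚ (fromℕ m) (fromℕ n))) (cong (ℚ._+ fromℕ n) (sym (fromℕ-suc m)))))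

fromℕ-homo-* : ∀ m n → fromℕ (m ℕ.* n) ≡ fromℕ m ℚ.* fromℕ n
fromℕ-homo-* zero    n = sym (ℚₚ.*-zeroˡ (fromℕ n))
fromℕ-homo-* (suc m) n = trans (fromℕ-+ n (m ℕ.* n))
  (trans (cong (fromℕ n ℚ.+_) (fromℕ-homo-* m n))
  (trans (solve 2 (λ a b → b :+ a :* b := (con 1ℚ :+ a) :* b) refl (fromℕ m) (fromℕ n))
    (cong (ℚ._* fromℕ n) (sym (fromℕ-suc m)))))

fromℕ-2^ : ∀ e → fromℕ (2 ℕ.^ e) ≡ 2ℚ ^ e
fromℕ-2^ zero    = refl
fromℕ-2^ (suc e) = trans (fromℕ-homo-* 2 (2 ℕ.^ e)) (cong (2ℚ ℚ.*_) (fromℕ-2^ e))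

0≤fromℕ : ∀ n → 0ℚ ℚ.≤ fromℕ n
0≤fromℕ n = ℚₚ.nonNegative⁻¹ (fromℕ n) {{ℚₚ.normalize-nonNeg n 1}}

0<fromℕ-suc : ∀ n → 0ℚ ℚ.< fromℕ (suc n)
0<fromℕ-suc n = ℚₚ.<-≤-trans 0<1 (1≤fromℕ {suc n} (ℕ.s≤s ℕ.z≤n))

fromℕ-mono-≤ : ∀ {m n} → m ℕ.≤ n → fromℕ m ℚ.≤ fromℕ n
fromℕ-mono-≤ {m} {n} m≤n = subst (fromℕ m ℚ.≤_)
  (trans (sym (fromℕ-+ m (n ℕ.∸ m))) (cong fromℕ (ℕₚ.m+[n∸m]≡n m≤n)))
  (p≤p+q (fromℕ m) (0≤fromℕ (n ℕ.∸ m)))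

fromℕ-mono-< : ∀ {m n} → m ℕ.< n → fromℕ m ℚ.< fromℕ n
fromℕ-mono-< {m} m<n = ℚₚ.<-≤-trans
  (subst (fromℕ m ℚ.<_) (trans (ℚₚ.+-comm (fromℕ m) 1ℚ) (sym (fromℕ-suc m))) (p<p+q (fromℕ m) 0<1))
  (fromℕ-mono-≤ m<n)

-- 1/1+ n is 1 / (n + 1).
abstract
  1/1+ : ℕ → ℚ
  1/1+ n = proj₁ (reciprocal (0<fromℕ-suc n))

  1/1+-pos : ∀ n → 0ℚ ℚ.< 1/1+ n
  1/1+-pos n = proj₁ (proj₂ (reciprocal (0<fromℕ-suc n)))

  1/1+-inverse : ∀ n → fromℕ (suc n) ℚ.* 1/1+ n ≡ 1ℚ
  1/1+-inverse n = proj₂ (proj₂ (reciprocal (0<fromℕ-suc n)))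

  1/1+0≡1 : 1/1+ 0 ≡ 1ℚ
  1/1+0≡1 = refl

  1/1+1≡½ : 1/1+ 1 ≡ ½
  1/1+1≡½ = refl

1/1+-anti-< : ∀ {m n} → m ℕ.< n → 1/1+ n ℚ.< 1/1+ m
1/1+-anti-< {m} {n} m<n = reciprocal-anti-< (0<fromℕ-suc m) (1/1+-pos n)
  (1/1+-inverse m) (1/1+-inverse n) (fromℕ-mono-< (ℕ.s≤s m<n))

1/1+-anti-≤ : ∀ {m n} → m ℕ.≤ n → 1/1+ n ℚ.≤ 1/1+ m
1/1+-anti-≤ {m} {n} m≤n with ℕₚ.m≤n⇒m<n∨m≡n m≤n
... | inj₁ m<n  = ℚₚ.<⇒≤ (1/1+-anti-< m<n)
... | inj₂ refl = ℚₚ.≤-refl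

1/1+≤1 : ∀ n → 1/1+ n ℚ.≤ 1ℚ
1/1+≤1 n = subst (1/1+ n ℚ.≤_) 1/1+0≡1 (1/1+-anti-≤ ℕ.z≤n)

1/1+-small : ∀ {ε} → 0ℚ ℚ.< ε → ∃[ n ] 1/1+ n ℚ.< ε
1/1+-small {ε} 0<ε =
  let c , 0<c , εc≡1 = reciprocal 0<ε
      n , c<n        = <fromℕ c
      c<1+n          = ℚₚ.<-trans c<n (fromℕ-mono-< (ℕₚ.n<1+n n))
  in  n , reciprocal-anti-< 0<c (1/1+-pos n) (trans (ℚₚ.*-comm c ε) εc≡1) (1/1+-inverse n) c<1+n

-- (1 + 1/c) / (c + 1) = 1/c with c = n + 1.
[1+1/1+n]/[2+n] : ∀ n → (1ℚ ℚ.+ 1/1+ n) ℚ.* 1/1+ (suc n) ≡ 1/1+ n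
[1+1/1+n]/[2+n] n = trans (cong (λ z → (z ℚ.+ u) ℚ.* v) (sym (1/1+-inverse n)))
  (trans (solve 3 (λ c u v → (c :* u :+ u) :* v := u :* ((con 1ℚ :+ c) :* v)) refl c u v)
  (trans (cong (λ z → u ℚ.* (z ℚ.* v)) (sym (fromℕ-suc (suc n))))
  (trans (cong (u ℚ.*_) (1/1+-inverse (suc n))) (ℚₚ.*-identityʳ u))))
  where
  c u v : ℚ
  c = fromℕ (suc n)
  u = 1/1+ n
  v = 1/1+ (suc n)

½*2≡1 : ½ ℚ.* 2ℚ ≡ 1ℚ
½*2≡1 = refl

½^*2^≡1 : ∀ n → ½ ^ n ℚ.* 2ℚ ^ n ≡ 1ℚ
½^*2^≡1 n = trans (sym (^-distrib-* ½ 2ℚ n)) (trans (cong (_^ n) ½*2≡1) (1^n≡1 n))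

½^<reciprocal : ∀ {ε c} n → 0ℚ ℚ.< c → ε ℚ.* c ≡ 1ℚ → c ℚ.< 2ℚ ^ n → ½ ^ n ℚ.< ε
½^<reciprocal {ε} {c} n 0<c εc≡1 c<2^n = reciprocal-anti-< {c} {2ℚ ^ n} {ε} {½ ^ n} 0<c (^-pos 0<½ n)
  (trans (ℚₚ.*-comm c ε) εc≡1) (trans (ℚₚ.*-comm (2ℚ ^ n) (½ ^ n)) (½^*2^≡1 n)) c<2^n

½^-small : ∀ {ε} → 0ℚ ℚ.< ε → ∃[ n ] ½ ^ n ℚ.< ε
½^-small {ε} 0<ε =
  case reciprocal 0<ε of λ (c , 0<c , εc≡1) →
  case ^-unbounded 1<2 c of λ (n , c<2^n) →
  n , ½^<reciprocal n 0<c εc≡1 c<2^n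

-- Cuts of sums and multiples

lower-≤ : ∀ x {p q} → p ℚ.≤ q → Lower x q → Lower x p
lower-≤ x p≤q Lq = let q′ , q<q′ , Lq′ = openˡ x Lq in closedˡ x (ℚₚ.≤-<-trans p≤q q<q′) Lq′

upper-≤ : ∀ x {p q} → p ℚ.≤ q → Upper x p → Upper x q
upper-≤ x p≤q Up = let p′ , p′<p , Up′ = openᵘ x Up in closedᵘ x (ℚₚ.<-≤-trans p′<p p≤q) Up′

lower-+ : ∀ x y {p q} → Lower x p → Lower y q → Lower (x +ᴿ y) (p ℚ.+ q)
lower-+ x y {q = q} Lp Lq = let p′ , p<p′ , Lp′ = openˡ x Lp in
  p′ , q , Lp′ , Lq , ℚₚ.+-monoˡ-< q p<p′

upper-+ : ∀ x y {p q} → Upper x p → Upper y q → Upper (x +ᴿ y) (p ℚ.+ q)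
upper-+ x y {q = q} Up Uq = let p′ , p′<p , Up′ = openᵘ x Up in
  p′ , q , Up′ , Uq , ℚₚ.+-monoˡ-< q p′<p

fromℕ-suc-* : ∀ n p → fromℕ (suc n) ℚ.* p ≡ p ℚ.+ fromℕ n ℚ.* p
fromℕ-suc-* n p = trans (cong (ℚ._* p) (fromℕ-suc n))
  (solve 2 (λ c p → (con 1ℚ :+ c) :* p := p :+ c :* p) refl (fromℕ n) p)

fromℕ-*-monoʳ-≤ : ∀ n {p q} → p ℚ.≤ q → fromℕ n ℚ.* p ℚ.≤ fromℕ n ℚ.* q
fromℕ-*-monoʳ-≤ n = ℚₚ.*-monoˡ-≤-nonNeg (fromℕ n) {{ℚₚ.normalize-nonNeg n 1}}

lower-• : ∀ n x {q} → Lower (n • x) q → ∃[ a ] Lower x a × q ℚ.< fromℕ n ℚ.* a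
lower-• zero    x {q} q<0 = let a , La = inhabitedˡ x in
  a , La , subst (q ℚ.<_) (sym (ℚₚ.*-zeroˡ a)) q<0
lower-• (suc n) x {q} (a , b , La , Lb , q<a+b) with lower-• n x Lb
... | a′ , La′ , b<na′ with ℚₚ.≤-total a a′
...   | inj₁ a≤a′ = a′ , La′ , subst (q ℚ.<_) (sym (fromℕ-suc-* n a′))
        (ℚₚ.<-trans q<a+b (ℚₚ.+-mono-≤-< a≤a′ b<na′))
...   | inj₂ a′≤a = a , La , subst (q ℚ.<_) (sym (fromℕ-suc-* n a))
        (ℚₚ.<-trans q<a+b (ℚₚ.+-monoʳ-< a (ℚₚ.<-≤-trans b<na′ (fromℕ-*-monoʳ-≤ n a′≤a))))

upper-• : ∀ n x {q} → Upper (n • x) q → ∃[ a ] Upper x a × fromℕ n ℚ.* a ℚ.< q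
upper-• zero    x {q} 0<q = let a , Ua = inhabitedᵘ x in
  a , Ua , subst (ℚ._< q) (sym (ℚₚ.*-zeroˡ a)) 0<q
upper-• (suc n) x {q} (a , b , Ua , Ub , a+b<q) with upper-• n x Ub
... | a′ , Ua′ , na′<b with ℚₚ.≤-total a a′
...   | inj₁ a≤a′ = a , Ua , subst (ℚ._< q) (sym (fromℕ-suc-* n a))
        (ℚₚ.<-trans (ℚₚ.+-monoʳ-< a (ℚₚ.≤-<-trans (fromℕ-*-monoʳ-≤ n a≤a′) na′<b)) a+b<q)
...   | inj₂ a′≤a = a′ , Ua′ , subst (ℚ._< q) (sym (fromℕ-suc-* n a′))
        (ℚₚ.<-trans (ℚₚ.+-mono-≤-< a′≤a na′<b) a+b<q)

≈ᴿ-refl : ∀ x → x ≈ᴿ x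
≈ᴿ-refl x = (λ (_ , U , L) → disjoint x L U) , (λ (_ , U , L) → disjoint x L U)

-- Points with prescribed Engel digits

-- A sequence g encodes the digits dₙ₊₁ = g n + 2.  The n-th point of the orbit
-- is the limit of the brackets below, which start from 0 < Tⁿ(x) ≤ 1/(dₙ₊₁ - 1)
-- and are pulled back along the inverse branches y ↦ (1 + y)/dₙ₊₁ of T.
branch : ℕ → ℚ → ℚ
branch d y = (1ℚ ℚ.+ y) ℚ.* 1/1+ (suc d)

branch-mono-< : ∀ d {p q} → p ℚ.< q → branch d p ℚ.< branch d q
branch-mono-< d p<q = *-posʳ-< (1/1+-pos (suc d)) (ℚₚ.+-monoʳ-< 1ℚ p<q)

branch-mono-≤ : ∀ d {p q} → p ℚ.≤ q → branch d p ℚ.≤ branch d q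
branch-mono-≤ d p≤q = *-posʳ-≤ (1/1+-pos (suc d)) (ℚₚ.+-monoʳ-≤ 1ℚ p≤q)

*-branch : ∀ d q → fromℕ (2 ℕ.+ d) ℚ.* branch d q ≡ 1ℚ ℚ.+ q
*-branch d q = trans
  (solve 3 (λ d v q → d :* ((con 1ℚ :+ q) :* v) := (d :* v) :* (con 1ℚ :+ q)) refl
    (fromℕ (2 ℕ.+ d)) (1/1+ (suc d)) q)
  (trans (cong (ℚ._* (1ℚ ℚ.+ q)) (1/1+-inverse (suc d))) (ℚₚ.*-identityˡ (1ℚ ℚ.+ q)))

branch-<⇒ : ∀ d {q a} → branch d q ℚ.< a → 1ℚ ℚ.+ q ℚ.< fromℕ (2 ℕ.+ d) ℚ.* a
branch-<⇒ d {q} {a} lt = subst (ℚ._< fromℕ (2 ℕ.+ d) ℚ.* a) (*-branch d q)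
  (*-posˡ-< (0<fromℕ-suc (suc d)) lt)

<-branch⇒ : ∀ d {q a} → a ℚ.< branch d q → fromℕ (2 ℕ.+ d) ℚ.* a ℚ.< 1ℚ ℚ.+ q
<-branch⇒ d {q} {a} lt = subst (fromℕ (2 ℕ.+ d) ℚ.* a ℚ.<_) (*-branch d q)
  (*-posˡ-< (0<fromℕ-suc (suc d)) lt)

branch-0 : ∀ d → branch d 0ℚ ≡ 1/1+ (suc d)
branch-0 d = trans (cong (ℚ._* 1/1+ (suc d)) (ℚₚ.+-identityʳ 1ℚ)) (ℚₚ.*-identityˡ (1/1+ (suc d)))

Nondecreasing : (ℕ → ℕ) → Set
Nondecreasing g = ∀ n → g n ℕ.≤ g (suc n)

lo hi : (ℕ → ℕ) → ℕ → ℕ → ℚ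
lo g zero    n = 0ℚ
lo g (suc j) n = branch (g n) (lo g j (suc n))
hi g zero    n = 1/1+ (g n)
hi g (suc j) n = branch (g n) (hi g j (suc n))

-- `1/1+ d` is the fixed point of `branch d`. This is where nondecreasing digits make the upper
-- brackets nest.
branch-1/1+-≤ : ∀ {d d′} → d ℕ.≤ d′ → branch d (1/1+ d′) ℚ.≤ 1/1+ d
branch-1/1+-≤ {d} {d′} d≤d′ = subst (branch d (1/1+ d′) ℚ.≤_) ([1+1/1+n]/[2+n] d)
  (branch-mono-≤ d (1/1+-anti-≤ d≤d′))

0≤branch : ∀ d {q} → 0ℚ ℚ.≤ q → 0ℚ ℚ.< branch d q
0≤branch d {q} 0≤q = *-pos (ℚₚ.<-≤-trans 0<1 (p≤p+q 1ℚ 0≤q)) (1/1+-pos (suc d))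

0<hi : ∀ g j n → 0ℚ ℚ.< hi g j n
0<hi g zero    n = 1/1+-pos (g n)
0<hi g (suc j) n = 0≤branch (g n) (ℚₚ.<⇒≤ (0<hi g j (suc n)))

lo<hi : ∀ g → Nondecreasing g → ∀ i j n → lo g i n ℚ.< hi g j n
lo<hi g g↑ zero    j       n = 0<hi g j n
lo<hi g g↑ (suc i) zero    n = ℚₚ.<-≤-trans
  (branch-mono-< (g n) (lo<hi g g↑ i zero (suc n))) (branch-1/1+-≤ (g↑ n))
lo<hi g g↑ (suc i) (suc j) n = branch-mono-< (g n) (lo<hi g g↑ i j (suc n))

-- Every digit is at least 2, so each branch contracts by a factor of at most ½.
hi≤lo+½^ : ∀ g j n → hi g j n ℚ.≤ lo g j n ℚ.+ ½ ^ j
hi≤lo+½^ g zero    n = subst (1/1+ (g n) ℚ.≤_) (sym (ℚₚ.+-identityˡ 1ℚ)) (1/1+≤1 (g n))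
hi≤lo+½^ g (suc j) n = ℚₚ.≤-trans (branch-mono-≤ (g n) (hi≤lo+½^ g j (suc n)))
  (subst (ℚ._≤ l′ ℚ.+ ½ ℚ.* ½ ^ j)
    (solve 3 (λ l h v → (con 1ℚ :+ l) :* v :+ v :* h := (con 1ℚ :+ (l :+ h)) :* v) refl
      (lo g j (suc n)) (½ ^ j) v)
    (ℚₚ.+-monoʳ-≤ l′ (*-posʳ-≤ (^-pos 0<½ j)
      (subst (v ℚ.≤_) 1/1+1≡½ (1/1+-anti-≤ (ℕ.s≤s ℕ.z≤n))))))
  where
  v l′ : ℚ
  v  = 1/1+ (suc (g n))
  l′ = lo g (suc j) n

locate : ∀ l h ε {p q} → h ℚ.≤ l ℚ.+ ε → ε ℚ.< q ℚ.- p → Dec (p ℚ.< l) → p ℚ.< l ⊎ h ℚ.< q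
locate l h ε         h≤l+ε ε<q-p (yes p<l) = inj₁ p<l
locate l h ε {p} {q} h≤l+ε ε<q-p (no  p≮l) = inj₂ (ℚₚ.≤-<-trans h≤l+ε
  (subst (l ℚ.+ ε ℚ.<_) (p+[q-p]≡q p q) (ℚₚ.+-mono-≤-< (ℚₚ.≮⇒≥ p≮l) ε<q-p)))

engel : ∀ g → Nondecreasing g → ℕ → ℝ
engel g g↑ n = record
  { Lower      = λ q → ∃[ j ] q ℚ.< lo g j n
  ; Upper      = λ q → ∃[ j ] hi g j n ℚ.< q
  ; inhabitedˡ = case inhabitedˡ 0ᴿ of λ (q , q<0) → q , 0 , q<0
  ; inhabitedᵘ = case inhabitedᵘ (fromℚ (hi g 0 n)) of λ (q , hi<q) → q , 0 , hi<q
  ; closedˡ    = λ p<q (j , q<lo) → j , ℚₚ.<-trans p<q q<lo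
  ; closedᵘ    = λ p<q (j , hi<p) → j , ℚₚ.<-trans hi<p p<q
  ; openˡ      = λ (j , p<lo) → case ℚₚ.<-dense p<lo of λ (q , p<q , q<lo) → q , p<q , j , q<lo
  ; openᵘ      = λ (j , hi<q) → case ℚₚ.<-dense hi<q of λ (p , hi<p , p<q) → p , p<q , j , hi<p
  ; disjoint   = λ (i , q<lo) (j , hi<q) → ℚₚ.<-asym (lo<hi g g↑ i j n) (ℚₚ.<-trans hi<q q<lo)
  ; located    = λ {p} p<q → case ½^-small (<⇒0<- p<q) of λ (j , ½^j<q-p) →
      Sum.map (j ,_) (j ,_)
        (locate (lo g j n) (hi g j n) (½ ^ j) (hi≤lo+½^ g j n) ½^j<q-p (p ℚₚ.<? lo g j n))
  }

-- Some digit after the n-th one is larger than it; otherwise the n-th point of the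
-- orbit would be 1/(dₙ₊₁ - 1), whose first digit is dₙ₊₁ - 1.
data EventuallyIncreases (g : ℕ → ℕ) (n : ℕ) : Set where
  here  : g n ℕ.< g (suc n) → EventuallyIncreases g n
  there : EventuallyIncreases g (suc n) → EventuallyIncreases g n

record Admissible (g : ℕ → ℕ) : Set where
  field
    nondecreasing : Nondecreasing g
    increases     : ∀ n → EventuallyIncreases g n

/1-mono-≤ : ∀ {i j} → i ℤ.≤ j → i ℚ./ 1 ℚ.≤ j ℚ./ 1
/1-mono-≤ {i} {j} i≤j = ℚₚ.toℚᵘ-cancel-≤
  (ℚᵘₚ.≤-respˡ-≃ (ℚᵘₚ.≃-sym (ℚₚ.toℚᵘ-fromℚᵘ (ℚᵘ.mkℚᵘ i 0)))
  (ℚᵘₚ.≤-respʳ-≃ (ℚᵘₚ.≃-sym (ℚₚ.toℚᵘ-fromℚᵘ (ℚᵘ.mkℚᵘ j 0)))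
    (ℚᵘ.*≤* (ℤₚ.*-monoʳ-≤-nonNeg (+ 1) i≤j))))

module _ (g : ℕ → ℕ) (adm : Admissible g) where
  open Admissible adm

  private
    x : ℕ → ℝ
    x = engel g nondecreasing

  engel-branch-lower : ∀ n {q} → Lower (x (suc n)) q → Lower (x n) (branch (g n) q)
  engel-branch-lower n (j , q<lo) = suc j , branch-mono-< (g n) q<lo

  engel-branch-upper : ∀ n {q} → Upper (x (suc n)) q → Upper (x n) (branch (g n) q)
  engel-branch-upper n (j , hi<q) = suc j , branch-mono-< (g n) hi<q

  engel-lower : ∀ n → Lower (x n) (1/1+ (suc (g n)))
  -- `lo g 1 n` equals `1/1+ (suc (g n))` itself; a second branch makes the inequality strict.
  engel-lower n = 2 , subst (ℚ._< lo g 2 n) (branch-0 (g n))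
    (branch-mono-< (g n) (0≤branch (g (suc n)) ℚₚ.≤-refl))

  -- A strict increase of the digits makes the upper bracket strict, and the branches of the
  -- preceding digits carry the strict bound back to position `n`.
  engel-upper : ∀ n → Upper (x n) (1/1+ (g n))
  engel-upper n = go (increases n)
    where
    go : ∀ {n} → EventuallyIncreases g n → Upper (x n) (1/1+ (g n))
    go {n} (here gn<) = upper-≤ (x n) (ℚₚ.≤-reflexive ([1+1/1+n]/[2+n] (g n)))
      (1 , branch-mono-< (g n) (1/1+-anti-< gn<))
    go {n} (there later) = upper-≤ (x n) (branch-1/1+-≤ (nondecreasing n))
      (engel-branch-upper n (go later))

  engel-pos : ∀ n → 0ᴿ <ᴿ x n
  engel-pos n = 1/1+ (suc (g n)) , 1/1+-pos (suc (g n)) , engel-lower n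

  engel-T : ∀ n → x (suc n) ≈ᴿ (2 ℕ.+ g n) • x n -ᴿ 1ᴿ
  engel-T n = above , below
    where
    d = 2 ℕ.+ g n
    shift : ∀ {a b q} → ℚ.- b ℚ.< 1ℚ → a ℚ.+ b ℚ.< q → a ℚ.< 1ℚ ℚ.+ q
    shift {a} {b} {q} -b<1 a+b<q = subst (ℚ._< 1ℚ ℚ.+ q)
      (solve 2 (λ a b → (con 0ℚ :- b) :+ (a :+ b) := a) refl a b)
      (ℚₚ.+-mono-< (subst (ℚ._< 1ℚ) (sym (ℚₚ.+-identityˡ (ℚ.- b))) -b<1) a+b<q)
    shift′ : ∀ {a b q} → 1ℚ ℚ.< ℚ.- b → q ℚ.< a ℚ.+ b → 1ℚ ℚ.+ q ℚ.< a
    shift′ {a} {b} {q} 1<-b q<a+b = subst (1ℚ ℚ.+ q ℚ.<_)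
      (solve 2 (λ a b → (con 0ℚ :- b) :+ (a :+ b) := a) refl a b)
      (ℚₚ.+-mono-< (subst (1ℚ ℚ.<_) (sym (ℚₚ.+-identityˡ (ℚ.- b))) 1<-b) q<a+b)
    above : x (suc n) ≤ᴿ d • x n -ᴿ 1ᴿ
    above (q , (a , b , Ua , -b<1 , a+b<q) , Lq) =
      let a′ , Ua′ , da′<a = upper-• d (x n) Ua
      in  ℚₚ.<-irrefl refl (ℚₚ.<-trans (shift -b<1 a+b<q)
            (ℚₚ.<-trans (branch-<⇒ (g n) {q} (lower<upper (x n) (engel-branch-lower n Lq) Ua′)) da′<a))
    below : d • x n -ᴿ 1ᴿ ≤ᴿ x (suc n)
    below (q , Uq , (a , b , La , 1<-b , q<a+b)) =
      let a′ , La′ , a<da′ = lower-• d (x n) La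
      in  ℚₚ.<-irrefl refl (ℚₚ.<-trans (shift′ 1<-b q<a+b)
            (ℚₚ.<-trans a<da′ (<-branch⇒ (g n) {q} (lower<upper (x n) La′ (engel-branch-upper n Uq)))))

  -- With d the digit, `engel-lower` gives 1/x ≤ d, and the strict bound `engel-upper` gives d - 1 <
  -- 1/x, which excludes every smaller integer.
  engel-firstDigit : ∀ n → IsFirstDigit (x n) (2 ℕ.+ g n)
  engel-firstDigit n = engel-pos n , ≤d , d≤
    where
    c d : ℕ
    c = suc (g n)
    d = suc c
    ≤d : inverse (x n) (engel-pos n) ≤ᴿ fromℤ (+ d)
    ≤d (q , d<q , (r , r⁻¹ , Ur , rr⁻¹≡1 , q<r⁻¹)) = ℚₚ.<-asym (ℚₚ.<-trans d<q q<r⁻¹)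
      (reciprocal-anti-< (1/1+-pos c)
        (reciprocal-pos (ℚₚ.<-trans (1/1+-pos c) 1/d<r) rr⁻¹≡1)
        (trans (ℚₚ.*-comm (1/1+ c) (fromℕ d)) (1/1+-inverse c)) rr⁻¹≡1 1/d<r)
      where
      1/d<r : 1/1+ c ℚ.< r
      1/d<r = lower<upper (x n) (engel-lower n) Ur
    c<inverse : fromℤ (+ c) <ᴿ inverse (x n) (engel-pos n)
    c<inverse =
      case openᵘ (x n) (engel-upper n) of λ (r , r<1/c , Ur) →
      case ℚₚ.<-trans (1/1+-pos c) (lower<upper (x n) (engel-lower n) Ur) of λ 0<r →
      case reciprocal 0<r of λ (r⁻¹ , 0<r⁻¹ , rr⁻¹≡1) →
      case ℚₚ.<-dense (reciprocal-anti-< 0<r (0<fromℕ-suc (g n)) rr⁻¹≡1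
        (trans (ℚₚ.*-comm (1/1+ (g n)) (fromℕ c)) (1/1+-inverse (g n))) r<1/c) of λ (q , c<q , q<r⁻¹) →
      q , c<q , r , r⁻¹ , Ur , rr⁻¹≡1 , q<r⁻¹
    d≤ : ∀ m → inverse (x n) (engel-pos n) ≤ᴿ fromℤ m → + d ℤ.≤ m
    d≤ m ≤m with + d ℤₚ.≤? m
    ... | yes d≤m = d≤m
    ... | no  d≰m = ⊥-elim (≤m (let q , c<q , Lq = c<inverse in
      q , ℚₚ.≤-<-trans (/1-mono-≤ (ℤₚ.i<j⇒i≤pred[j] (ℤₚ.≰⇒> d≰m))) c<q , Lq))

-- Powers `d ^- s` for `d` a power of two

2^-mono-< : ∀ {i j} → i ℕ.< j → 2ℚ ^ i ℚ.< 2ℚ ^ j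
2^-mono-< {i} i<j = ℚₚ.<-≤-trans
  (subst (ℚ._< 2ℚ ^ suc i) (ℚₚ.*-identityˡ (2ℚ ^ i)) (*-posʳ-< (^-pos 0<2 i) 1<2))
  (^-monoʳ-≤ (ℚₚ.<⇒≤ 1<2) i<j)

[2^*½^]^*2^ : ∀ e L M m b →
  (2ℚ ^ L ℚ.* ½ ^ M) ^ b ℚ.* (2ℚ ^ e) ^ m ≡ 2ℚ ^ (L ℕ.* b ℕ.+ e ℕ.* m) ℚ.* ½ ^ (M ℕ.* b)
[2^*½^]^*2^ e L M m b = trans
  (cong₂ ℚ._*_
    (trans (^-distrib-* (2ℚ ^ L) (½ ^ M) b) (cong₂ ℚ._*_ (^-assocʳ 2ℚ L b) (^-assocʳ ½ M b)))
    (^-assocʳ 2ℚ e m))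
  (trans (solve 3 (λ x y z → (x :* y) :* z := (x :* z) :* y) refl
           (2ℚ ^ (L ℕ.* b)) (½ ^ (M ℕ.* b)) (2ℚ ^ (e ℕ.* m)))
    (cong (ℚ._* ½ ^ (M ℕ.* b)) (sym (^-homo-* 2ℚ (L ℕ.* b) (e ℕ.* m)))))

2^≡2^*½^ : ∀ e n k → (2ℚ ^ e) ^ n ≡ 2ℚ ^ (e ℕ.* n ℕ.+ k) ℚ.* ½ ^ k
2^≡2^*½^ e n k = sym (trans (cong (ℚ._* ½ ^ k) (^-homo-* 2ℚ (e ℕ.* n) k))
  (trans (ℚₚ.*-assoc (2ℚ ^ (e ℕ.* n)) (2ℚ ^ k) (½ ^ k))
  (trans (cong (2ℚ ^ (e ℕ.* n) ℚ.*_) (trans (ℚₚ.*-comm (2ℚ ^ k) (½ ^ k)) (½^*2^≡1 k)))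
  (trans (ℚₚ.*-identityʳ (2ℚ ^ (e ℕ.* n))) (sym (^-assocʳ 2ℚ e n))))))

2^_^-_ : ℕ → ℝ → ℝ
2^ e ^- s = _^-_ (2 ℕ.^ e) {{ℕₚ.m^n≢0 2 e}} s

-- Cleared of roots, the claim compares two powers of 2. The product `2ℚ ^ L ℚ.* ½ ^ M` stands for
-- the power with exponent L - M, of either sign.
2^[-s]-lower : ∀ e s m n b L M → Upper s (ratio m n b) →
  suc L ℕ.* suc b ℕ.+ e ℕ.* m ℕ.< e ℕ.* n ℕ.+ M ℕ.* suc b →
  Lower (2^ e ^- s) (2ℚ ^ L ℚ.* ½ ^ M)
2^[-s]-lower e s m n b L M Us lt =
  -- The cut asks for a witness strictly above the claimed bound; doubling provides one, at the
  -- price of `suc L` in the hypothesis.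
  2ℚ ^ suc L ℚ.* ½ ^ M , m , n , b ,
  *-posʳ-< (^-pos 0<½ M) (2^-mono-< (ℕₚ.n<1+n L)) , Us , λ _ →
  subst (λ D → (2ℚ ^ suc L ℚ.* ½ ^ M) ^ suc b ℚ.* D ^ m ℚ.< D ^ n) (sym (fromℕ-2^ e))
    (subst₂ ℚ._<_ (sym ([2^*½^]^*2^ e (suc L) M m (suc b))) (sym (2^≡2^*½^ e n (M ℕ.* suc b)))
      (*-posʳ-< (^-pos 0<½ (M ℕ.* suc b)) (2^-mono-< lt)))

2^[-s]-upper : ∀ e s m n b M → Lower s (ratio m n b) →
  e ℕ.* n ℕ.+ suc M ℕ.* suc b ℕ.< e ℕ.* m → Upper (2^ e ^- s) (½ ^ M)
2^[-s]-upper e s m n b M Ls lt =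
  2ℚ ^ 0 ℚ.* ½ ^ suc M , m , n , b ,
  subst₂ ℚ._<_ (sym (ℚₚ.*-identityˡ (½ ^ suc M))) (ℚₚ.*-identityˡ (½ ^ M)) (*-posʳ-< (^-pos 0<½ M) ½<1) ,
  Ls , *-pos (^-pos 0<2 0) (^-pos 0<½ (suc M)) ,
  subst (λ D → D ^ n ℚ.< (2ℚ ^ 0 ℚ.* ½ ^ suc M) ^ suc b ℚ.* D ^ m) (sym (fromℕ-2^ e))
    (subst₂ ℚ._<_ (sym (2^≡2^*½^ e n (suc M ℕ.* suc b))) (sym ([2^*½^]^*2^ e 0 (suc M) m (suc b)))
      (*-posʳ-< (^-pos 0<½ (suc M ℕ.* suc b)) (2^-mono-< lt)))

-- As `p ≤ 1`, the power is at most `p`, and p E = 1 - p. This yields a positive rational below a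
-- root of 1/E without extracting the root.
1+E-reciprocal : ∀ {E p} b → 0ℚ ℚ.< E → 0ℚ ℚ.< p → (1ℚ ℚ.+ E) ℚ.* p ≡ 1ℚ → p ^ suc b ℚ.* E ℚ.< 1ℚ
1+E-reciprocal {E} {p} b 0<E 0<p [1+E]p≡1 = ℚₚ.≤-<-trans
  (*-posʳ-≤ 0<E (subst (p ^ suc b ℚ.≤_) (ℚₚ.*-identityʳ p) (*-posˡ-≤ 0<p p^b≤1)))
  (subst (p ℚ.* E ℚ.<_) pE+p≡1 (p<p+q (p ℚ.* E) 0<p))
  where
  pE+p≡1 : p ℚ.* E ℚ.+ p ≡ 1ℚ
  pE+p≡1 = trans (solve 2 (λ p E → p :* E :+ p := (con 1ℚ :+ E) :* p) refl p E) [1+E]p≡1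
  p≤1 : p ℚ.≤ 1ℚ
  p≤1 = subst (p ℚ.≤_) (trans (ℚₚ.+-comm p (p ℚ.* E)) pE+p≡1) (p≤p+q p (ℚₚ.<⇒≤ (*-pos 0<p 0<E)))
  p^b≤1 : p ^ b ℚ.≤ 1ℚ
  p^b≤1 = subst (p ^ b ℚ.≤_) (1^n≡1 b) (^-monoˡ-≤ 0<p p≤1 b)

^-‿pos : ∀ d .{{_ : ℕ.NonZero d}} s → Lower (d ^- s) 0ℚ
^-‿pos d s =
  case inhabitedᵘ s of λ (r , Ur) →
  case ratio-surjective r of λ (m , n , b , r≡) →
  case ^-pos 0<D m of λ 0<D^m →
  case reciprocal (ℚₚ.<-trans 0<1 (p<p+q 1ℚ 0<D^m)) of λ (p , 0<p , e) →
  p , m , n , b , 0<p , subst (Upper s) r≡ Ur , λ _ →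
  ℚₚ.<-≤-trans (1+E-reciprocal b 0<D^m 0<p e) (1≤^ 1≤D n)
  where
  1≤D : 1ℚ ℚ.≤ fromℕ d
  1≤D = 1≤fromℕ (ℕ.>-nonZero⁻¹ d)
  0<D : 0ℚ ℚ.< fromℕ d
  0<D = ℚₚ.<-≤-trans 0<1 1≤D

-- Integer approximations to multiples of a real

-- In the two lemmas below (m - n)/B and (m′ - n′)/B′ are rationals between the
-- exponent s of a term and the number a that M/e approximates with error 1/e.
M-large : ∀ m n B m′ n′ B′ M e L .{{_ : ℕ.NonZero B}} → m ℕ.* B′ ℕ.+ n′ ℕ.* B ℕ.< m′ ℕ.* B ℕ.+ n ℕ.* B′ →
  m′ ℕ.* e ℕ.< suc M ℕ.* B′ ℕ.+ n′ ℕ.* e → B ℕ.* B′ ℕ.* suc L ℕ.≤ e →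
  L ℕ.* B ℕ.+ e ℕ.* m ℕ.< e ℕ.* n ℕ.+ M ℕ.* B
M-large m n B m′ n′ B′ M e L s<a a<M+1 large =
  ℕₚ.*-cancelʳ-< B′ _ _ (ℕₚ.+-cancelʳ-< (n′ ℕ.* B ℕ.* e ℕ.+ m′ ℕ.* B ℕ.* e ℕ.+ B ℕ.* B′) _ _ (begin-strict
    (L ℕ.* B ℕ.+ e ℕ.* m) ℕ.* B′ ℕ.+ (n′ ℕ.* B ℕ.* e ℕ.+ m′ ℕ.* B ℕ.* e ℕ.+ B ℕ.* B′)
      ≡⟨ ℕ-solve 7 (λ L B e m B′ n′ m′ →
           (L ⊛ B ⊕ e ⊛ m) ⊛ B′ ⊕ (n′ ⊛ B ⊛ e ⊕ m′ ⊛ B ⊛ e ⊕ B ⊛ B′)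
           ⊜ B ⊛ B′ ⊛ (κ 1 ⊕ L) ⊕ (e ⊛ (m ⊛ B′ ⊕ n′ ⊛ B) ⊕ B ⊛ (m′ ⊛ e)))
           refl L B e m B′ n′ m′ ⟩
    -- `s<a` is strict between natural numbers, so multiplying it by `e` leaves a slack of `e`,
    -- which pays for `B ℕ.* B′ ℕ.* suc L`.
    B ℕ.* B′ ℕ.* suc L ℕ.+ (e ℕ.* (m ℕ.* B′ ℕ.+ n′ ℕ.* B) ℕ.+ B ℕ.* (m′ ℕ.* e))
      ≤⟨ ℕₚ.+-monoˡ-≤ _ large ⟩
    e ℕ.+ (e ℕ.* (m ℕ.* B′ ℕ.+ n′ ℕ.* B) ℕ.+ B ℕ.* (m′ ℕ.* e))
      ≡⟨ ℕ-solve 3 (λ e p q → e ⊕ (e ⊛ p ⊕ q) ⊜ e ⊛ (κ 1 ⊕ p) ⊕ q)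
           refl e (m ℕ.* B′ ℕ.+ n′ ℕ.* B) (B ℕ.* (m′ ℕ.* e)) ⟩
    e ℕ.* suc (m ℕ.* B′ ℕ.+ n′ ℕ.* B) ℕ.+ B ℕ.* (m′ ℕ.* e)
      <⟨ ℕₚ.+-mono-≤-< (ℕₚ.*-monoʳ-≤ e s<a) (ℕₚ.*-monoʳ-< B a<M+1) ⟩
    e ℕ.* (m′ ℕ.* B ℕ.+ n ℕ.* B′) ℕ.+ B ℕ.* (suc M ℕ.* B′ ℕ.+ n′ ℕ.* e)
      ≡⟨ ℕ-solve 7 (λ e m′ B n B′ M n′ →
           e ⊛ (m′ ⊛ B ⊕ n ⊛ B′) ⊕ B ⊛ ((κ 1 ⊕ M) ⊛ B′ ⊕ n′ ⊛ e)
           ⊜ (e ⊛ n ⊕ M ⊛ B) ⊛ B′ ⊕ (n′ ⊛ B ⊛ e ⊕ m′ ⊛ B ⊛ e ⊕ B ⊛ B′))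
           refl e m′ B n B′ M n′ ⟩
    (e ℕ.* n ℕ.+ M ℕ.* B) ℕ.* B′ ℕ.+ (n′ ℕ.* B ℕ.* e ℕ.+ m′ ℕ.* B ℕ.* e ℕ.+ B ℕ.* B′) ∎))
  where open ℕₚ.≤-Reasoning

M-small : ∀ m n B m′ n′ B′ M e L .{{_ : ℕ.NonZero B}} → m′ ℕ.* B ℕ.+ n ℕ.* B′ ℕ.< m ℕ.* B′ ℕ.+ n′ ℕ.* B →
  M ℕ.* B′ ℕ.+ n′ ℕ.* e ℕ.< m′ ℕ.* e ℕ.+ B′ → B ℕ.* B′ ℕ.* suc L ℕ.≤ e →
  e ℕ.* n ℕ.+ (L ℕ.+ M) ℕ.* B ℕ.< e ℕ.* m
M-small m n B m′ n′ B′ M e L a<s M-1<a large =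
  ℕₚ.*-cancelʳ-< B′ _ _ (ℕₚ.+-cancelʳ-< (n′ ℕ.* B ℕ.* e ℕ.+ m′ ℕ.* B ℕ.* e ℕ.+ B ℕ.* B′) _ _ (begin-strict
    (e ℕ.* n ℕ.+ (L ℕ.+ M) ℕ.* B) ℕ.* B′ ℕ.+ (n′ ℕ.* B ℕ.* e ℕ.+ m′ ℕ.* B ℕ.* e ℕ.+ B ℕ.* B′)
      ≡⟨ ℕ-solve 8 (λ L B e n B′ n′ m′ M →
           (e ⊛ n ⊕ (L ⊕ M) ⊛ B) ⊛ B′ ⊕ (n′ ⊛ B ⊛ e ⊕ m′ ⊛ B ⊛ e ⊕ B ⊛ B′)
           ⊜ B ⊛ B′ ⊛ (κ 1 ⊕ L) ⊕ (e ⊛ (m′ ⊛ B ⊕ n ⊛ B′) ⊕ B ⊛ (M ⊛ B′ ⊕ n′ ⊛ e)))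
           refl L B e n B′ n′ m′ M ⟩
    B ℕ.* B′ ℕ.* suc L ℕ.+ (e ℕ.* (m′ ℕ.* B ℕ.+ n ℕ.* B′) ℕ.+ B ℕ.* (M ℕ.* B′ ℕ.+ n′ ℕ.* e))
      ≤⟨ ℕₚ.+-monoˡ-≤ _ large ⟩
    e ℕ.+ (e ℕ.* (m′ ℕ.* B ℕ.+ n ℕ.* B′) ℕ.+ B ℕ.* (M ℕ.* B′ ℕ.+ n′ ℕ.* e))
      ≡⟨ ℕ-solve 3 (λ e p q → e ⊕ (e ⊛ p ⊕ q) ⊜ e ⊛ (κ 1 ⊕ p) ⊕ q)
           refl e (m′ ℕ.* B ℕ.+ n ℕ.* B′) (B ℕ.* (M ℕ.* B′ ℕ.+ n′ ℕ.* e)) ⟩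
    e ℕ.* suc (m′ ℕ.* B ℕ.+ n ℕ.* B′) ℕ.+ B ℕ.* (M ℕ.* B′ ℕ.+ n′ ℕ.* e)
      <⟨ ℕₚ.+-mono-≤-< (ℕₚ.*-monoʳ-≤ e a<s) (ℕₚ.*-monoʳ-< B M-1<a) ⟩
    e ℕ.* (m ℕ.* B′ ℕ.+ n′ ℕ.* B) ℕ.+ B ℕ.* (m′ ℕ.* e ℕ.+ B′)
      ≡⟨ ℕ-solve 6 (λ e m B′ n′ B m′ →
           e ⊛ (m ⊛ B′ ⊕ n′ ⊛ B) ⊕ B ⊛ (m′ ⊛ e ⊕ B′)
           ⊜ (e ⊛ m) ⊛ B′ ⊕ (n′ ⊛ B ⊛ e ⊕ m′ ⊛ B ⊛ e ⊕ B ⊛ B′))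
           refl e m B′ n′ B m′ ⟩
    (e ℕ.* m) ℕ.* B′ ℕ.+ (n′ ℕ.* B ℕ.* e ℕ.+ m′ ℕ.* B ℕ.* e ℕ.+ B ℕ.* B′) ∎))
  where open ℕₚ.≤-Reasoning

-- ℕ-valued approximation M of e a, for e = b + 1 and a ≥ 0.
IsScaledApproximation : ℝ → ℕ → ℕ → Set
IsScaledApproximation a b M = Lower a (ratio M 1 b) × Upper a (ratio (suc M) 0 b)

nonNeg-lower : ∀ a → 0ᴿ ≤ᴿ a → ∀ {q} → q ℚ.< 0ℚ → Lower a q
nonNeg-lower a 0≤a q<0 = case ℚₚ.<-dense q<0 of λ (p , q<p , p<0) →
  case located a q<p of λ
    { (inj₁ Lq) → Lq
    ; (inj₂ Up) → ⊥-elim (0≤a (_ , Up , p<0))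
    }

ratio-0-1 : ∀ b → ratio 0 1 b ℚ.< 0ℚ
ratio-0-1 b = subst (ratio 0 1 b ℚ.<_) (ratio-1-1 b) (ratio-<-suc 0 1 b)
  where
  ratio-1-1 : ∀ b → ratio 1 1 b ≡ 0ℚ
  ratio-1-1 b = ℚₚ.toℚᵘ-injective (ℚᵘₚ.≃-trans (ℚₚ.toℚᵘ-fromℚᵘ (ℚᵘ.mkℚᵘ (+ 0) b)) (ℚᵘ.*≡* refl))

ratio-unbounded : ∀ q b → ∃[ M ] q ℚ.< ratio M 0 b
ratio-unbounded q b = case <fromℕ q of λ (M , q<M) → suc b ℕ.* M ,
  subst (q ℚ.<_) (ℚₚ.toℚᵘ-injective (ℚᵘₚ.≃-trans (ℚₚ.toℚᵘ-fromℚᵘ (ℚᵘ.mkℚᵘ (+ M) 0))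
    (ℚᵘₚ.≃-trans (ℚᵘ.*≡* (eq M)) (ℚᵘₚ.≃-sym (ℚₚ.toℚᵘ-fromℚᵘ (ℚᵘ.mkℚᵘ (+ (suc b ℕ.* M)) b)))))) q<M
  where
  eq : ∀ M → + M ℤ.* + suc b ≡ + (suc b ℕ.* M) ℤ.* + 1
  eq M = trans (ℤₚ.*-comm (+ M) (+ suc b)) (trans (sym (ℤₚ.pos-* (suc b) M))
    (sym (ℤₚ.*-identityʳ (+ (suc b ℕ.* M)))))

-- Locatedness decides between the overlapping alternatives M/e < a and a < (M + 1)/e. The search
-- moves up until the second is returned; `fuel` is the distance to a known upper bound.
scaledApproximation : ∀ a → 0ᴿ ≤ᴿ a → ∀ b → ∃ (IsScaledApproximation a b)
scaledApproximation a 0≤a b = case inhabitedᵘ a of λ (q , Uq) →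
  case ratio-unbounded q b of λ (N , q<N) →
  search N 0 (closedᵘ a (subst (λ k → q ℚ.< ratio k 0 b) (sym (ℕₚ.+-identityʳ N)) q<N) Uq)
    (nonNeg-lower a 0≤a (ratio-0-1 b))
  where
  search : ∀ fuel M → Upper a (ratio (fuel ℕ.+ M) 0 b) → Lower a (ratio M 1 b) →
           ∃ (IsScaledApproximation a b)
  search zero    M UM LM = M , LM , closedᵘ a (ratio-<-suc M 0 b) UM
  search (suc f) M UM LM with located a (ratio-<-suc M 0 b)
  ... | inj₂ UM+1 = M , LM , UM+1
  ... | inj₁ LM+1 = search f (suc M)
    (subst (λ k → Upper a (ratio k 0 b)) (sym (ℕₚ.+-suc f M)) UM) LM+1

n<2^n : ∀ n → n ℕ.< 2 ℕ.^ n
n<2^n zero    = ℕ.s≤s ℕ.z≤n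
n<2^n (suc n) = ℕₚ.+-mono-≤ (ℕₚ.m^n>0 2 n)
  (ℕₚ.≤-trans (n<2^n n) (ℕₚ.≤-reflexive (sym (ℕₚ.+-identityʳ (2 ℕ.^ n)))))

-- Levels, block digits and paths

abstract
  -- Convergence applies `M-small` with L = k + 2, which requires B B′ (k + 3) ≤ e. The factor
  -- `3 ℕ.+ k` matches this, and the factor `suc k` eventually exceeds the fixed B B′.
  exponent : ℕ → ℕ
  exponent k = suc k ℕ.* (3 ℕ.+ k)

  exponent≡ : ∀ k → exponent k ≡ suc k ℕ.* (3 ℕ.+ k)
  exponent≡ k = refl

  -- The predecessor of `exponent k`, since `ratio` takes its denominator diminished by one.
  exponent′ : ℕ → ℕ
  exponent′ k = 2 ℕ.+ k ℕ.+ k ℕ.* (3 ℕ.+ k)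

  exponent≡suc : ∀ k → suc (exponent′ k) ≡ exponent k
  exponent≡suc k = refl

  3+k≤exponent : ∀ k → 3 ℕ.+ k ℕ.≤ exponent k
  3+k≤exponent k = ℕₚ.m≤m+n (3 ℕ.+ k) (k ℕ.* (3 ℕ.+ k))

  exponent-< : ∀ k → exponent k ℕ.< exponent (suc k)
  exponent-< k = ℕₚ.*-mono-< (ℕₚ.n<1+n (suc k)) (ℕₚ.n<1+n (3 ℕ.+ k))

2≤2^exponent : ∀ k → 2 ℕ.≤ 2 ℕ.^ exponent k
2≤2^exponent k = ℕₚ.≤-trans (ℕ.s≤s (ℕ.s≤s ℕ.z≤n))
  (ℕₚ.≤-trans (3+k≤exponent k) (ℕₚ.<⇒≤ (n<2^n (exponent k))))

-- The digits on level k are 2 ^ exponent k = blockDigit k + 2.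
blockDigit : ℕ → ℕ
blockDigit k = 2 ℕ.^ exponent k ℕ.∸ 2

2+blockDigit : ∀ k → 2 ℕ.+ blockDigit k ≡ 2 ℕ.^ exponent k
2+blockDigit k = ℕₚ.m+[n∸m]≡n (2≤2^exponent k)

k≤blockDigit : ∀ k → k ℕ.≤ blockDigit k
k≤blockDigit k = ℕₚ.+-cancelˡ-≤ 2 k (blockDigit k) (begin
  2 ℕ.+ k              ≤⟨ ℕₚ.n≤1+n (2 ℕ.+ k) ⟩
  3 ℕ.+ k              ≤⟨ 3+k≤exponent k ⟩
  exponent k           ≤⟨ ℕₚ.<⇒≤ (n<2^n (exponent k)) ⟩
  2 ℕ.^ exponent k     ≡⟨ sym (2+blockDigit k) ⟩
  2 ℕ.+ blockDigit k   ∎)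
  where open ℕₚ.≤-Reasoning

-- A first digit d puts a point between 1/d and 1/(d - 1). Digits that differ by at least 2 leave a
-- gap between these ranges, which `Avoid` relies on.
1+blockDigit< : ∀ k → suc (blockDigit k) ℕ.< blockDigit (suc k)
1+blockDigit< k = ℕₚ.+-cancelˡ-≤ 2 _ _ (begin
  2 ℕ.+ (2 ℕ.+ blockDigit k)              ≡⟨ cong (2 ℕ.+_) (2+blockDigit k) ⟩
  2 ℕ.+ 2 ℕ.^ exponent k                  ≤⟨ ℕₚ.+-monoˡ-≤ _ (2≤2^exponent k) ⟩
  2 ℕ.^ exponent k ℕ.+ 2 ℕ.^ exponent k   ≡⟨ cong (2 ℕ.^ exponent k ℕ.+_) (sym (ℕₚ.+-identityʳ _)) ⟩
  2 ℕ.^ suc (exponent k)                  ≤⟨ ℕₚ.^-monoʳ-≤ 2 (exponent-< k) ⟩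
  2 ℕ.^ exponent (suc k)                  ≡⟨ sym (2+blockDigit (suc k)) ⟩
  2 ℕ.+ blockDigit (suc k)                ∎)
  where open ℕₚ.≤-Reasoning

-- In position (k , i) the current digit has level k.  Level k lasts for 2 ^ M k
-- or 2 ^ M k + 1 digits, and i counts down from 2 ^ M k.
data Step (M : ℕ → ℕ) : ℕ × ℕ → ℕ × ℕ → Set where
  stay  : ∀ {k i} → Step M (k , suc i) (k , i)
  leave : ∀ {k i} → i ℕ.≤ 1 → Step M (k , i) (suc k , 2 ℕ.^ M (suc k))

record Path (M : ℕ → ℕ) : Set where
  field
    position : ℕ → ℕ × ℕ
    step     : ∀ n → Step M (position n) (position (suc n))

  step-from : ∀ n {p} → position n ≡ p → Step M p (position (suc n))
  step-from n e = subst (λ p → Step M p (position (suc n))) e (step n)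

  nextLevel : ∀ i n {k} → position n ≡ (k , i) →
              ∃[ n′ ] position n′ ≡ (suc k , 2 ℕ.^ M (suc k))
  nextLevel i n {k} e = go i (step-from n e) refl
    where
    go : ∀ i {p} → Step M (k , i) p → position (suc n) ≡ p →
         ∃[ n′ ] position n′ ≡ (suc k , 2 ℕ.^ M (suc k))
    go (suc i) stay      e = nextLevel i (suc n) e
    go i       (leave _) e = suc n , e

  reach : ∀ K → ∃[ n ] ∃[ k ] K ℕ.≤ k × position n ≡ (k , 2 ℕ.^ M k)
  reach zero    = let n , e = nextLevel (proj₂ (position 0)) 0 refl in n , _ , ℕ.z≤n , e
  reach (suc K) = let n , k , K≤k , e = reach K
                      n′ , e′         = nextLevel (2 ℕ.^ M k) n e
                  in  n′ , suc k , ℕ.s≤s K≤k , e′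

record EventuallyFollows (M : ℕ → ℕ) (g : ℕ → ℕ) : Set where
  field
    path   : Path M
    offset : ℕ
  open Path path public
  field
    agrees : ∀ n → g (n ℕ.+ offset) ≡ blockDigit (proj₁ (position n))

-- Divergence and convergence of the digit series

digits : (ℕ → ℕ) → ℕ → Maybe ℕ⁺
digits g n = just (suc (suc (g n)) , _)

term-2^ : ∀ d (d≢0 : ℕ.NonZero d) e s → d ≡ 2 ℕ.^ e → term (just (d , d≢0)) s ≡ 2^ e ^- s
term-2^ d d≢0 e s refl = refl

-- The lower cut of the empty sum holds only negative rationals. The choice of -1 is harmless, as
-- blocks of arbitrarily large sum are added to it.
partialSum-lower : ∀ g s N → Lower (partialSum (digits g) s N) (ℚ.- 1ℚ)
partialSum-lower g s zero    = ℚₚ.neg-antimono-< 0<1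
partialSum-lower g s (suc N) = lower-+ (partialSum (digits g) s N) (term (digits g N) s)
  (partialSum-lower g s N) (^-‿pos (suc (suc (g N))) s)

partialSum-upper : ∀ g s j N {q} →
  Upper (partialSum (digits g) s (j ℕ.+ N)) q → Upper (partialSum (digits g) s N) q
partialSum-upper g s zero    N U = U
partialSum-upper g s (suc j) N {q} (a , b , Ua , Ub , a+b<q) = partialSum-upper g s j N
  (closedᵘ (partialSum (digits g) s (j ℕ.+ N))
    (ℚₚ.<-trans (p<p+q a (lower<upper (term (digits g (j ℕ.+ N)) s) (^-‿pos (suc (suc (g (j ℕ.+ N)))) s) Ub)) a+b<q) Ua)

-- With r = (m - n)/(b + 1) > s and e = `exponent k`, the inequality reads M k - e r > L + 1: the
-- 2^(M k) terms of a level together exceed 2^L.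
Diverging : (ℕ → ℕ) → ℝ → Set
Diverging M s = ∃[ m ] ∃[ n ] ∃[ b ] Upper s (ratio m n b) × (∀ L → ∃[ K ] ∀ k → K ℕ.≤ k →
  suc L ℕ.* suc b ℕ.+ exponent k ℕ.* m ℕ.< exponent k ℕ.* n ℕ.+ M k ℕ.* suc b)

-- With r = (m - n)/(b + 1) < s, the inequality reads e r > M k + k + 2: each term is so small that
-- level k contributes at most about 2^(-k).
Converging : (ℕ → ℕ) → ℝ → Set
Converging M s = ∃[ m ] ∃[ n ] ∃[ b ] Lower s (ratio m n b) × (∃[ K ] ∀ k → K ℕ.≤ k →
  exponent k ℕ.* n ℕ.+ (2 ℕ.+ k ℕ.+ M k) ℕ.* suc b ℕ.< exponent k ℕ.* m)

module _ {M g : ℕ → ℕ} (follows : EventuallyFollows M g) (s : ℝ) where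
  open EventuallyFollows follows

  private
    Σs : ℕ → ℝ
    Σs = partialSum (digits g) s

    Tm : ℕ → ℝ
    Tm n = term (digits g n) s

  term-level : ∀ n {k i} → position n ≡ (k , i) → Tm (n ℕ.+ offset) ≡ 2^ exponent k ^- s
  term-level n {k} e = term-2^ (suc (suc (g (n ℕ.+ offset)))) _ (exponent k) s
    (trans (cong (2 ℕ.+_) (trans (agrees n) (cong (λ p → blockDigit (proj₁ p)) e))) (2+blockDigit k))

  climb : ∀ {k p} → Lower (2^ exponent k ^- s) p → ∀ i n {q} → position n ≡ (k , i) →
          Lower (Σs (n ℕ.+ offset)) q → ∃[ N ] Lower (Σs N) (q ℚ.+ fromℕ i ℚ.* p)
  climb {k} {p} Lp zero    n {q} e Lq = n ℕ.+ offset ,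
    subst (Lower (Σs (n ℕ.+ offset))) (sym (trans (cong (q ℚ.+_) (ℚₚ.*-zeroˡ p)) (ℚₚ.+-identityʳ q))) Lq
  climb {k} {p} Lp (suc i) n {q} e Lq = go (step-from n e) refl
    where
    Lq+p : Lower (Σs (suc n ℕ.+ offset)) (q ℚ.+ p)
    Lq+p = lower-+ (Σs (n ℕ.+ offset)) (Tm (n ℕ.+ offset)) {q} {p} Lq
      (subst (λ x → Lower x p) (sym (term-level n {k} e)) Lp)
    sum≡ : ∀ i → (q ℚ.+ p) ℚ.+ fromℕ i ℚ.* p ≡ q ℚ.+ fromℕ (suc i) ℚ.* p
    sum≡ i = trans (ℚₚ.+-assoc q p (fromℕ i ℚ.* p)) (cong (q ℚ.+_) (sym (fromℕ-suc-* i p)))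
    go : ∀ {p′} → Step M (k , suc i) p′ → position (suc n) ≡ p′ →
         ∃[ N ] Lower (Σs N) (q ℚ.+ fromℕ (suc i) ℚ.* p)
    go stay e′ = case climb Lp i (suc n) e′ Lq+p of λ (N , LN) →
      N , subst (Lower (Σs N)) (sum≡ i) LN
    -- A level can be left here only at count 1, when the single term still owed has just been
    -- added.
    go (leave (ℕ.s≤s ℕ.z≤n)) _ = suc n ℕ.+ offset , subst (Lower (Σs (suc n ℕ.+ offset)))
      (trans (sym (trans (cong ((q ℚ.+ p) ℚ.+_) (ℚₚ.*-zeroˡ p)) (ℚₚ.+-identityʳ (q ℚ.+ p)))) (sum≡ 0)) Lq+p

  2^*[2^*½^] : ∀ L n → ℚ.- 1ℚ ℚ.+ fromℕ (2 ℕ.^ n) ℚ.* (2ℚ ^ L ℚ.* ½ ^ n) ≡ ℚ.- 1ℚ ℚ.+ 2ℚ ^ L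
  2^*[2^*½^] L n = cong (ℚ.- 1ℚ ℚ.+_) (trans (cong (ℚ._* (2ℚ ^ L ℚ.* ½ ^ n)) (fromℕ-2^ n))
    (trans (solve 3 (λ a b c → a :* (b :* c) := b :* (c :* a)) refl (2ℚ ^ n) (2ℚ ^ L) (½ ^ n))
    (trans (cong (2ℚ ^ L ℚ.*_) (½^*2^≡1 n)) (ℚₚ.*-identityʳ (2ℚ ^ L)))))

  -- One sufficiently late level alone pushes the partial sum beyond the supposed bound.
  diverging⇒¬finite : Diverging M s → ¬ FiniteSum (digits g) s
  diverging⇒¬finite (m , n , b , Us , large) (B , bounded) =
    case inhabitedᵘ B of λ (u , Uu) →
    case ^-unbounded 1<2 (1ℚ ℚ.+ u) of λ (L , 1+u<2^L) →
    case large L of λ (K , large-K) →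
    case reach K of λ (t , k , K≤k , e) →
    case climb {k} {2ℚ ^ L ℚ.* ½ ^ M k} (2^[-s]-lower (exponent k) s m n b L (M k) Us (large-K k K≤k)) (2 ℕ.^ M k) t e
      (partialSum-lower g s (t ℕ.+ offset)) of λ (N , LN) →
    bounded N (u , Uu , lower-≤ (Σs N) (u≤ u L 1+u<2^L) (subst (Lower (Σs N)) (2^*[2^*½^] L (M k)) LN))
    where
    u≤ : ∀ u L → 1ℚ ℚ.+ u ℚ.< 2ℚ ^ L → u ℚ.≤ ℚ.- 1ℚ ℚ.+ 2ℚ ^ L
    u≤ u L lt = subst (ℚ._≤ ℚ.- 1ℚ ℚ.+ 2ℚ ^ L)
      (trans (sym (ℚₚ.+-assoc (ℚ.- 1ℚ) 1ℚ u)) (ℚₚ.+-identityˡ u)) (ℚₚ.+-monoʳ-≤ (ℚ.- 1ℚ) (ℚₚ.<⇒≤ lt))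

½^+½^ : ∀ n → ½ ^ suc n ℚ.+ ½ ^ suc n ≡ ½ ^ n
½^+½^ n = trans (sym (ℚₚ.*-distribʳ-+ (½ ^ n) ½ ½)) (ℚₚ.*-identityˡ (½ ^ n))

[1+2^]*½^ : ∀ n k → fromℕ (suc (2 ℕ.^ n)) ℚ.* ½ ^ (2 ℕ.+ k ℕ.+ n) ℚ.≤ ½ ^ suc k
[1+2^]*½^ n k = ℚₚ.≤-trans
  (*-posʳ-≤ (^-pos 0<½ (2 ℕ.+ k ℕ.+ n)) (fromℕ-mono-≤ 1+2^n≤2^1+n))
  (ℚₚ.≤-reflexive (begin
    fromℕ (2 ℕ.^ suc n) ℚ.* ½ ^ (2 ℕ.+ k ℕ.+ n)
      ≡⟨ cong₂ (λ x j → x ℚ.* ½ ^ j) (fromℕ-2^ (suc n)) (exponent-split n k) ⟩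
    2ℚ ^ suc n ℚ.* ½ ^ (suc n ℕ.+ suc k)
      ≡⟨ cong (2ℚ ^ suc n ℚ.*_) (^-homo-* ½ (suc n) (suc k)) ⟩
    2ℚ ^ suc n ℚ.* (½ ^ suc n ℚ.* ½ ^ suc k)
      ≡⟨ solve 3 (λ a b c → a :* (b :* c) := (b :* a) :* c) refl (2ℚ ^ suc n) (½ ^ suc n) (½ ^ suc k) ⟩
    ½ ^ suc n ℚ.* 2ℚ ^ suc n ℚ.* ½ ^ suc k
      ≡⟨ cong (ℚ._* ½ ^ suc k) (½^*2^≡1 (suc n)) ⟩
    1ℚ ℚ.* ½ ^ suc k
      ≡⟨ ℚₚ.*-identityˡ (½ ^ suc k) ⟩
    ½ ^ suc k ∎))
  where
  open ≡-Reasoning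
  exponent-split : ∀ n k → 2 ℕ.+ k ℕ.+ n ≡ suc n ℕ.+ suc k
  exponent-split = ℕ-solve 2 (λ n k → κ 2 ⊕ k ⊕ n ⊜ (κ 1 ⊕ n) ⊕ (κ 1 ⊕ k)) refl
  1+2^n≤2^1+n : suc (2 ℕ.^ n) ℕ.≤ 2 ℕ.^ suc n
  1+2^n≤2^1+n = ℕₚ.≤-trans (ℕₚ.+-monoˡ-≤ (2 ℕ.^ n) (ℕₚ.m^n>0 2 n))
    (ℕₚ.≤-reflexive (cong (2 ℕ.^ n ℕ.+_) (sym (ℕₚ.+-identityʳ (2 ℕ.^ n)))))

module _ (M : ℕ → ℕ) where

  termBound : ℕ → ℚ
  termBound k = ½ ^ (suc k ℕ.+ M k)

  -- Bounds the sum of all terms from position (k , i) on, if the terms of level k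
  -- are at most termBound k: level k contributes at most (i + 1) (termBound k),
  -- and each later level j at most (2 ^ M j + 1) (termBound j) ≤ ½ ^ j.
  remainder : ℕ × ℕ → ℚ
  remainder (k , i) = fromℕ (suc i) ℚ.* termBound k ℚ.+ ½ ^ k

  remainder-step : ∀ {p p′} → Step M p p′ →
    termBound (proj₁ p) ℚ.+ remainder p′ ℚ.≤ remainder p
  remainder-step {k , suc i} stay = ℚₚ.≤-reflexive
    (trans (sym (ℚₚ.+-assoc (termBound k) (fromℕ (suc i) ℚ.* termBound k) (½ ^ k)))
      (cong (ℚ._+ ½ ^ k) (sym (fromℕ-suc-* (suc i) (termBound k)))))
  remainder-step {k , i} (leave _) = ℚₚ.+-mono-≤
    (subst (termBound k ℚ.≤_) (sym (fromℕ-suc-* i (termBound k)))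
      (p≤p+q (termBound k) (0≤fromℕ-* i (termBound-pos k))))
    (ℚₚ.≤-trans (ℚₚ.+-monoˡ-≤ (½ ^ suc k) ([1+2^]*½^ (M (suc k)) k)) (ℚₚ.≤-reflexive (½^+½^ k)))
    where
    termBound-pos : ∀ k → 0ℚ ℚ.< termBound k
    termBound-pos k = ^-pos 0<½ (suc k ℕ.+ M k)
    0≤fromℕ-* : ∀ i {p} → 0ℚ ℚ.< p → 0ℚ ℚ.≤ fromℕ i ℚ.* p
    0≤fromℕ-* i {p} 0<p = subst (ℚ._≤ fromℕ i ℚ.* p) (ℚₚ.*-zeroˡ p) (*-posʳ-≤ 0<p (0≤fromℕ i))

  0≤remainder : ∀ p → 0ℚ ℚ.≤ remainder p
  0≤remainder (k , i) = ℚₚ.<⇒≤ (ℚₚ.<-trans (*-pos (0<fromℕ-suc i) (^-pos 0<½ (suc k ℕ.+ M k)))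
    (p<p+q (fromℕ (suc i) ℚ.* termBound k) (^-pos 0<½ k)))

level-mono : ∀ {M p p′} → Step M p p′ → proj₁ p ℕ.≤ proj₁ p′
level-mono stay              = ℕₚ.≤-refl
level-mono {p = k , _} (leave _) = ℕₚ.n≤1+n k

module _ {M g : ℕ → ℕ} (follows : EventuallyFollows M g) (s : ℝ) where
  open EventuallyFollows follows

  private
    Σs : ℕ → ℝ
    Σs = partialSum (digits g) s

  -- `remainder` acts as a potential: by `remainder-step`, the bound on the partial sum plus the
  -- remainder never grows along the path.
  bounded-from : ∀ K → (∀ k → K ℕ.≤ k → Upper (2^ exponent k ^- s) (termBound M k)) →
    ∀ n₀ {u} → K ℕ.≤ proj₁ (position n₀) → Upper (Σs (n₀ ℕ.+ offset)) u → ∀ j →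
    K ℕ.≤ proj₁ (position (j ℕ.+ n₀)) × (∃[ v ] Upper (Σs (j ℕ.+ n₀ ℕ.+ offset)) v ×
      v ℚ.+ remainder M (position (j ℕ.+ n₀)) ℚ.≤ u ℚ.+ remainder M (position n₀))
  bounded-from K small n₀ {u} K≤ Uu zero    = K≤ , u , Uu , ℚₚ.≤-refl
  bounded-from K small n₀ {u} K≤ Uu (suc j) =
    case bounded-from K small n₀ K≤ Uu j of λ (K≤j , v , Uv , v+r≤) →
    ℕₚ.≤-trans K≤j (level-mono (step n)) , v ℚ.+ t n ,
    upper-+ (Σs (n ℕ.+ offset)) (term (digits g (n ℕ.+ offset)) s) {v} {t n} Uv
      (subst (λ x → Upper x (t n)) (sym (term-level follows s n refl)) (small (proj₁ (position n)) K≤j)) ,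
    ℚₚ.≤-trans
      (subst (ℚ._≤ v ℚ.+ remainder M (position n)) (sym (ℚₚ.+-assoc v (t n) (remainder M (position (suc n)))))
        (ℚₚ.+-monoʳ-≤ v (remainder-step M (step n))))
      v+r≤
    where
    n : ℕ
    n = j ℕ.+ n₀
    t : ℕ → ℚ
    t n = termBound M (proj₁ (position n))

  converging⇒finite : Converging M s → FiniteSum (digits g) s
  converging⇒finite (m , n , b , Ls , K , small-K) =
    case reach K of λ (n₀ , k , K≤k , e) →
    case inhabitedᵘ (Σs (n₀ ℕ.+ offset)) of λ (u , Uu) →
    fromℚ (u ℚ.+ remainder M (position n₀)) ,
    λ N (q , B<q , Lq) → ℚₚ.<-asym B<q (lower<upper (Σs N) Lq
      (bound N n₀ (subst (λ p → K ℕ.≤ proj₁ p) (sym e) K≤k) Uu))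
    where
    small : ∀ k → K ℕ.≤ k → Upper (2^ exponent k ^- s) (termBound M k)
    small k K≤k = 2^[-s]-upper (exponent k) s m n b (suc k ℕ.+ M k) Ls (small-K k K≤k)
    bound : ∀ N n₀ {u} → K ℕ.≤ proj₁ (position n₀) → Upper (Σs (n₀ ℕ.+ offset)) u →
            Upper (Σs N) (u ℚ.+ remainder M (position n₀))
    bound N n₀ {u} K≤ Uu =
      case bounded-from K small n₀ K≤ Uu N of λ (_ , v , Uv , v+r≤) →
      -- The terms are positive, so a bound at the later index `N ℕ.+ n₀ ℕ.+ offset` also holds at
      -- `N`; this covers the prefix and the early levels.
      partialSum-upper g s (n₀ ℕ.+ offset) N
        (subst (λ j → Upper (Σs j) (u ℚ.+ remainder M (position n₀))) (trans (ℕₚ.+-assoc N n₀ offset) (ℕₚ.+-comm N (n₀ ℕ.+ offset)))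
          (upper-≤ (Σs (N ℕ.+ n₀ ℕ.+ offset)) {v}
            (ℚₚ.≤-trans (p≤p+q v (0≤remainder M (position (N ℕ.+ n₀)))) v+r≤) Uv))

-- Block lengths for a given exponent

Calibrated : (ℕ → ℕ) → [0,∞] → Set₁
Calibrated M (fin a _) = (∀ s → s <ᴿ a → Diverging M s) × (∀ s → a <ᴿ s → Converging M s)
Calibrated M ∞         = ∀ s → Diverging M s

k≤exponent : ∀ k → k ℕ.≤ exponent k
k≤exponent k = ℕₚ.≤-trans (ℕₚ.m≤n+m k 3) (3+k≤exponent k)

module _ (a : ℝ) {M : ℕ → ℕ} (M≈ : ∀ k → IsScaledApproximation a (exponent′ k) (M k)) where

  approximation-diverging : ∀ s → s <ᴿ a → Diverging M s
  approximation-diverging s (q , Us , La) =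
    case openˡ a La of λ (q′ , q<q′ , La′) →
    case ratio-surjective q of λ (m , n , b , q≡) →
    case ratio-surjective q′ of λ (m′ , n′ , b′ , q′≡) →
    m , n , b , subst (Upper s) q≡ Us , λ L → suc b ℕ.* suc b′ ℕ.* (2 ℕ.+ L) , λ k K≤k →
    large m n b m′ n′ b′ (subst₂ ℚ._<_ q≡ q′≡ q<q′) (subst (Lower a) q′≡ La′) L k K≤k
    where
    large : ∀ m n b m′ n′ b′ → ratio m n b ℚ.< ratio m′ n′ b′ → Lower a (ratio m′ n′ b′) →
      ∀ L k → suc b ℕ.* suc b′ ℕ.* (2 ℕ.+ L) ℕ.≤ k →
      suc L ℕ.* suc b ℕ.+ exponent k ℕ.* m ℕ.< exponent k ℕ.* n ℕ.+ M k ℕ.* suc b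
    large m n b m′ n′ b′ q<q′ La′ L k K≤k = subst
      (λ e → suc L ℕ.* suc b ℕ.+ e ℕ.* m ℕ.< e ℕ.* n ℕ.+ M k ℕ.* suc b) (exponent≡suc k)
      (M-large m n (suc b) m′ n′ (suc b′) (M k) (suc (exponent′ k)) (suc L)
        (ratio-<⇒< m n b m′ n′ b′ q<q′)
        (subst (ℕ._< suc (M k) ℕ.* suc b′ ℕ.+ n′ ℕ.* suc (exponent′ k)) (ℕₚ.+-identityʳ _)
          (ratio-<⇒< m′ n′ b′ (suc (M k)) 0 (exponent′ k) (lower<upper a La′ (proj₂ (M≈ k)))))
        (ℕₚ.≤-trans K≤k (subst (k ℕ.≤_) (sym (exponent≡suc k)) (k≤exponent k))))

  approximation-converging : ∀ s → a <ᴿ s → Converging M s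
  approximation-converging s (q , Ua , Ls) =
    case openᵘ a Ua of λ (q′ , q′<q , Ua′) →
    case ratio-surjective q of λ (m , n , b , q≡) →
    case ratio-surjective q′ of λ (m′ , n′ , b′ , q′≡) →
    m , n , b , subst (Lower s) q≡ Ls , suc b ℕ.* suc b′ , λ k K≤k →
    small m n b m′ n′ b′ (subst₂ ℚ._<_ q′≡ q≡ q′<q) (subst (Upper a) q′≡ Ua′) k K≤k
    where
    small : ∀ m n b m′ n′ b′ → ratio m′ n′ b′ ℚ.< ratio m n b → Upper a (ratio m′ n′ b′) →
      ∀ k → suc b ℕ.* suc b′ ℕ.≤ k →
      exponent k ℕ.* n ℕ.+ (2 ℕ.+ k ℕ.+ M k) ℕ.* suc b ℕ.< exponent k ℕ.* m
    small m n b m′ n′ b′ q′<q Ua′ k K≤k = subst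
      (λ e → e ℕ.* n ℕ.+ (2 ℕ.+ k ℕ.+ M k) ℕ.* suc b ℕ.< e ℕ.* m) (exponent≡suc k)
      (M-small m n (suc b) m′ n′ (suc b′) (M k) (suc (exponent′ k)) (2 ℕ.+ k)
        (ratio-<⇒< m′ n′ b′ m n b q′<q)
        (subst (M k ℕ.* suc b′ ℕ.+ n′ ℕ.* suc (exponent′ k) ℕ.<_)
          (cong (m′ ℕ.* suc (exponent′ k) ℕ.+_) (ℕₚ.+-identityʳ (suc b′)))
          (ratio-<⇒< (M k) 1 (exponent′ k) m′ n′ b′ (lower<upper a (proj₁ (M≈ k)) Ua′)))
        (ℕₚ.≤-trans (ℕₚ.*-monoˡ-≤ (3 ℕ.+ k) (ℕₚ.≤-trans K≤k (ℕₚ.n≤1+n k)))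
          (ℕₚ.≤-reflexive (trans (sym (exponent≡ k)) (sym (exponent≡suc k))))))

infinite-diverging : ∀ s → Diverging (λ k → exponent k ℕ.* k) s
infinite-diverging s =
  case inhabitedᵘ s of λ (q , Us) →
  case ratio-surjective q of λ (m , n , b , q≡) →
  m , n , b , subst (Upper s) q≡ Us , λ L → suc (suc L ℕ.+ m) , large m n b L
  where
  large : ∀ m n b L k → suc (suc L ℕ.+ m) ℕ.≤ k →
    suc L ℕ.* suc b ℕ.+ exponent k ℕ.* m ℕ.< exponent k ℕ.* n ℕ.+ exponent k ℕ.* k ℕ.* suc b
  large m n b L k K≤k = begin-strict
    suc L ℕ.* suc b ℕ.+ e ℕ.* m
      ≤⟨ ℕₚ.+-mono-≤ (ℕₚ.m≤n*m (suc L ℕ.* suc b) e) (ℕₚ.m≤m*n (e ℕ.* m) (suc b)) ⟩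
    e ℕ.* (suc L ℕ.* suc b) ℕ.+ e ℕ.* m ℕ.* suc b
      ≡⟨ ℕ-solve 4 (λ e L m B → e ⊛ (L ⊛ B) ⊕ (e ⊛ m) ⊛ B ⊜ (e ⊛ (L ⊕ m)) ⊛ B) refl e (suc L) m (suc b) ⟩
    e ℕ.* (suc L ℕ.+ m) ℕ.* suc b
      <⟨ ℕₚ.*-monoˡ-< (suc b) (ℕₚ.*-monoʳ-< e K≤k) ⟩
    e ℕ.* k ℕ.* suc b
      ≤⟨ ℕₚ.m≤n+m (e ℕ.* k ℕ.* suc b) (e ℕ.* n) ⟩
    e ℕ.* n ℕ.+ e ℕ.* k ℕ.* suc b ∎
    where
    open ℕₚ.≤-Reasoning
    e : ℕ
    e = exponent k
    instance
      e≢0 : ℕ.NonZero e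
      e≢0 = ℕ.>-nonZero (ℕₚ.≤-trans (ℕ.s≤s ℕ.z≤n) (3+k≤exponent k))

calibrated : ∀ α → ∃[ M ] Calibrated M α
calibrated (fin a 0≤a) = choose λ k → scaledApproximation a 0≤a (exponent′ k)
  where
  choose : (∀ k → ∃ (IsScaledApproximation a (exponent′ k))) → ∃[ M ] Calibrated M (fin a 0≤a)
  choose approx = (λ k → proj₁ (approx k)) ,
    approximation-diverging a {λ k → proj₁ (approx k)} (λ k → proj₂ (approx k)) ,
    approximation-converging a {λ k → proj₁ (approx k)} (λ k → proj₂ (approx k))
calibrated ∞ = (λ k → exponent k ℕ.* k) , infinite-diverging

-- Rational exponents suffice to test greatest lower bounds: if β exceeds a, the series converges at
-- any rational strictly between them, so β is not a lower bound.
isInfimum : ∀ α {M g} → Calibrated M α → EventuallyFollows M g → IsInfimum (FiniteSum (digits g)) α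
isInfimum (fin a 0≤a) {M} {g} (div , conv) follows =
  (λ s _ finite s<a → diverging⇒¬finite follows s (div s s<a) finite) , greatest
  where
  rational : ∀ {q} → Upper a q → FiniteSum (digits g) (fromℚ q)
  rational {q} Uq = case openᵘ a Uq of λ (p , p<q , Up) →
    converging⇒finite follows (fromℚ q) (conv (fromℚ q) (p , Up , p<q))
  0≤ : ∀ {q} → Upper a q → 0ᴿ ≤ᴿ fromℚ q
  0≤ Uq (p , q<p , p<0) = 0≤a (p , closedᵘ a q<p Uq , p<0)
  greatest : ∀ β → (∀ s (0≤s : 0ᴿ ≤ᴿ s) → FiniteSum (digits g) s → β ≤∞ fin s 0≤s) → β ≤∞ fin a 0≤a
  greatest (fin b _) lowerBound (q , Ua , Lb) = case openˡ b Lb of λ (r , q<r , Lr) →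
    lowerBound (fromℚ q) (0≤ Ua) (rational Ua) (r , q<r , Lr)
  greatest ∞ lowerBound = case inhabitedᵘ a of λ (q , Ua) → lowerBound (fromℚ q) (0≤ Ua) (rational Ua)
isInfimum ∞ {g = g} div follows =
  (λ s _ finite → diverging⇒¬finite follows s (div s) finite) , greatest
  where
  greatest : ∀ β → (∀ s (0≤s : 0ᴿ ≤ᴿ s) → FiniteSum (digits g) s → β ≤∞ fin s 0≤s) → β ≤∞ ∞
  greatest (fin _ _) _ = _
  greatest ∞         _ = _

inLevelSet : ∀ α {M g} → Calibrated M α → (adm : Admissible g) → EventuallyFollows M g →
  LevelSet α (engel g (Admissible.nondecreasing adm) 0)
inLevelSet α {M} {g} cal adm follows = engel-pos g adm 0 ,
  x<1 , expansion , isInfimum α cal follows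
  where
  x : ℕ → ℝ
  x = engel g (Admissible.nondecreasing adm)
  x<1 : x 0 <ᴿ 1ᴿ
  x<1 = case openᵘ (x 0) (engel-upper g adm 0) of λ (q , q<1/c , Uq) →
    q , Uq , ℚₚ.<-≤-trans q<1/c (1/1+≤1 (g 0))
  expansion : EngelExpansion (x 0)
  expansion = record
    { orbit      = x
    ; orbit-zero = ≈ᴿ-refl (x 0)
    ; orbit-suc  = λ n → positive (2 ℕ.+ g n) (engel-firstDigit g adm n) (engel-T g adm n)
    ; digit      = digits g
    ; digit-at   = engel-firstDigit g adm
    }

-- Digit sequences of paths

blockDigit-step : ∀ {M p p′} → Step M p p′ → blockDigit (proj₁ p) ℕ.≤ blockDigit (proj₁ p′)
blockDigit-step stay                  = ℕₚ.≤-refl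
blockDigit-step {p = k , _} (leave _) = ℕₚ.<⇒≤ (ℕₚ.<-trans (ℕₚ.n<1+n _) (1+blockDigit< k))

module _ {M : ℕ → ℕ} (path : Path M) where
  open Path path

  pathDigits : ℕ → ℕ
  pathDigits n = blockDigit (proj₁ (position n))

  pathDigits-admissible : Admissible pathDigits
  pathDigits-admissible = record
    { nondecreasing = λ n → blockDigit-step (step n)
    ; increases     = λ n → increases (proj₂ (position n)) n refl
    }
    where
    increases : ∀ i n {k} → position n ≡ (k , i) → EventuallyIncreases pathDigits n
    increases i n {k} e = go i (step-from n e) refl e
      where
      go : ∀ i {p} → Step M (k , i) p → position (suc n) ≡ p → position n ≡ (k , i) →
           EventuallyIncreases pathDigits n
      go (suc i) stay      e′ e = there (increases i (suc n) e′)
      go i       (leave _) e′ e = here (subst₂ (λ p p′ → blockDigit (proj₁ p) ℕ.< blockDigit (proj₁ p′))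
        (sym e) (sym e′) (ℕₚ.<-trans (ℕₚ.n<1+n _) (1+blockDigit< k)))

  pathDigits-follows : EventuallyFollows M pathDigits
  pathDigits-follows = record
    { path   = path
    ; offset = 0
    ; agrees = λ n → cong pathDigits (ℕₚ.+-identityʳ n)
    }

  levelStart : position 0 ≡ (0 , 2 ℕ.^ M 0) → ∀ k → ∃[ n ] position n ≡ (k , 2 ℕ.^ M k)
  levelStart e zero    = 0 , e
  levelStart e (suc k) = let n , e′ = levelStart e k in nextLevel (2 ℕ.^ M k) n e′

  countdown : ∀ i n {k} → position n ≡ (k , suc i) → ∃[ n′ ] position n′ ≡ (k , 1)
  countdown zero    n     e = n , e
  countdown (suc i) n {k} e = go (step-from n e) refl
    where
    go : ∀ {p} → Step M (k , suc (suc i)) p → position (suc n) ≡ p → ∃[ n′ ] position n′ ≡ (k , 1)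
    go stay                e′ = countdown i (suc n) e′
    go (leave (ℕ.s≤s ())) e′

  -- Count 1 is where the length of a level is decided. It occurs on every level, as the count
  -- starts at a positive power and a level cannot be left from a count of 2 or more.
  reach-1 : position 0 ≡ (0 , 2 ℕ.^ M 0) → ∀ k → ∃[ n ] position n ≡ (k , 1)
  reach-1 e k = let n , e′ = levelStart e k in
    countdown (ℕ.pred (2 ℕ.^ M k)) n
      (trans e′ (cong (k ,_) (sym (ℕₚ.suc-pred (2 ℕ.^ M k) {{ℕₚ.m^n≢0 2 (M k)}}))))

-- Uncountability

-- A path whose Engel series avoids every f k.  After 2 ^ M k digits of level k the
-- point is scale * y + shift, where y is a later point of the orbit: another digit
-- of level k makes y large and a digit of level k + 1 makes it small, and f k is
-- located with respect to the gap between these two options.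
module Avoid (M : ℕ → ℕ) (f : ℕ → ℝ) where

  record State : Set where
    field
      pos         : ℕ × ℕ
      shift scale : ℚ
      0<scale     : 0ℚ ℚ.< scale
    level count : ℕ
    level = proj₁ pos
    count = proj₂ pos
    digitInverse shift′ scale′ : ℚ
    digitInverse = 1/1+ (suc (blockDigit level))
    shift′ = shift ℚ.+ scale ℚ.* digitInverse
    scale′ = scale ℚ.* digitInverse
    0<scale′ : 0ℚ ℚ.< scale′
    0<scale′ = *-pos 0<scale (1/1+-pos (suc (blockDigit level)))

  open State

  -- `shift′` and `scale′` already include the current digit. In the first case `f` lies above
  -- everything reachable by leaving the level now, in the second below everything reachable by
  -- staying; the path moves accordingly.
  Choice : State → Set
  Choice s = Lower (f (level s)) (shift′ s ℚ.+ scale′ s ℚ.* 1/1+ (blockDigit (suc (level s))))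
           ⊎ Upper (f (level s)) (shift′ s ℚ.+ scale′ s ℚ.* 1/1+ (suc (blockDigit (level s))))

  choose : ∀ s → Choice s
  choose s = located (f (level s))
    (ℚₚ.+-monoʳ-< (shift′ s) (*-posˡ-< (0<scale′ s) (1/1+-anti-< (1+blockDigit< (level s)))))

  move : ∀ {a b} {A : Set a} {B : Set b} → ℕ → ℕ → A ⊎ B → ℕ × ℕ
  move k zero          _        = suc k , 2 ℕ.^ M (suc k)
  move k (suc zero)    (inj₁ _) = suc k , 2 ℕ.^ M (suc k)
  move k (suc zero)    (inj₂ _) = k , 0
  move k (suc (suc i)) _        = k , suc i

  move-step : ∀ {a b} {A : Set a} {B : Set b} k i (c : A ⊎ B) → Step M (k , i) (move k i c)
  move-step k zero          _        = leave ℕ.z≤n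
  move-step k (suc zero)    (inj₁ _) = leave (ℕ.s≤s ℕ.z≤n)
  move-step k (suc zero)    (inj₂ _) = stay
  move-step k (suc (suc i)) _        = stay

  next : State → State
  next s = record
    { pos     = move (level s) (count s) (choose s)
    ; shift   = shift′ s
    ; scale   = scale′ s
    ; 0<scale = 0<scale′ s
    }

  state : ℕ → State
  state zero    = record { pos = 0 , 2 ℕ.^ M 0 ; shift = 0ℚ ; scale = 1ℚ ; 0<scale = 0<1 }
  state (suc n) = next (state n)

  path : Path M
  path = record
    { position = λ n → pos (state n)
    ; step     = λ n → move-step (level (state n)) (count (state n)) (choose (state n))
    }

  g : ℕ → ℕ
  g = pathDigits path

  adm : Admissible g
  adm = pathDigits-admissible path

  x : ℕ → ℝ
  x = engel g (Admissible.nondecreasing adm)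

  affine-branch : ∀ s t v y → s ℚ.+ t ℚ.* ((1ℚ ℚ.+ y) ℚ.* v) ≡ (s ℚ.+ t ℚ.* v) ℚ.+ (t ℚ.* v) ℚ.* y
  affine-branch = solve 4 (λ s t v y → s :+ t :* ((con 1ℚ :+ y) :* v) := (s :+ t :* v) :+ (t :* v) :* y) refl

  affine-0 : ∀ y → y ≡ 0ℚ ℚ.+ 1ℚ ℚ.* y
  affine-0 y = sym (trans (ℚₚ.+-identityˡ (1ℚ ℚ.* y)) (ℚₚ.*-identityˡ y))

  x₀-lower : ∀ n {y} → Lower (x n) y → Lower (x 0) (shift (state n) ℚ.+ scale (state n) ℚ.* y)
  x₀-lower zero    {y} L = subst (Lower (x 0)) (affine-0 y) L
  x₀-lower (suc n) {y} L = subst (Lower (x 0))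
    (affine-branch (shift (state n)) (scale (state n)) (digitInverse (state n)) y)
    (x₀-lower n {branch (g n) y} (engel-branch-lower g adm n {y} L))

  x₀-upper : ∀ n {y} → Upper (x n) y → Upper (x 0) (shift (state n) ℚ.+ scale (state n) ℚ.* y)
  x₀-upper zero    {y} U = subst (Upper (x 0)) (affine-0 y) U
  x₀-upper (suc n) {y} U = subst (Upper (x 0))
    (affine-branch (shift (state n)) (scale (state n)) (digitInverse (state n)) y)
    (x₀-upper n {branch (g n) y} (engel-branch-upper g adm n {y} U))

  avoids-at : ∀ n → count (state n) ≡ 1 → ¬ (f (level (state n)) ≈ᴿ x 0)
  avoids-at n e = go (count (state n)) (choose (state n)) e refl
    where
    s : State
    s = state n
    go : ∀ i (c : Choice s) → i ≡ 1 → pos (state (suc n)) ≡ move (level s) i c →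
         ¬ (f (level s) ≈ᴿ x 0)
    go _ (inj₁ L) refl e (f≤x , _) = f≤x (_ , subst
      (λ p → Upper (x 0) (shift′ s ℚ.+ scale′ s ℚ.* 1/1+ (blockDigit (proj₁ p)))) e
      (x₀-upper (suc n) {1/1+ (g (suc n))} (engel-upper g adm (suc n))) , L)
    go _ (inj₂ U) refl e (_ , x≤f) = x≤f (_ , U , subst
      (λ p → Lower (x 0) (shift′ s ℚ.+ scale′ s ℚ.* 1/1+ (suc (blockDigit (proj₁ p))))) e
      (x₀-lower (suc n) {1/1+ (suc (g (suc n)))} (engel-lower g adm (suc n))))

  avoids : ∀ k → ¬ (f k ≈ᴿ x 0)
  avoids k = case reach-1 path refl k of λ (n , e) →
    subst (λ j → ¬ (f j ≈ᴿ x 0)) (cong proj₁ e) (avoids-at n (cong proj₂ e))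

uncountable : ∀ α → Uncountable (LevelSet α)
uncountable α (f , covers) = case calibrated α of λ (M , cal) →
  let open Avoid M f in
  case covers (x 0) (inLevelSet α cal adm (pathDigits-follows path)) of λ (n , fn≈x) →
  avoids n fn≈x

-- Density

fromLevel : ∀ M k₀ → Σ[ path ∈ Path M ] Path.position path 0 ≡ (k₀ , 2 ℕ.^ M k₀)
fromLevel M k₀ = record { position = position ; step = λ n → next-step (position n) } , refl
  where
  next : ℕ × ℕ → ℕ × ℕ
  next (k , zero)  = suc k , 2 ℕ.^ M (suc k)
  next (k , suc i) = k , i
  next-step : ∀ p → Step M p (next p)
  next-step (k , zero)  = leave ℕ.z≤n
  next-step (k , suc i) = stay
  position : ℕ → ℕ × ℕ
  position zero    = k₀ , 2 ℕ.^ M k₀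
  position (suc n) = next (position n)

cons : ℕ → (ℕ → ℕ) → ℕ → ℕ
cons a g zero    = a
cons a g (suc n) = g n

lo-cons : ∀ a g j n → lo (cons a g) j (suc n) ≡ lo g j n
lo-cons a g zero    n = refl
lo-cons a g (suc j) n = cong (branch (g n)) (lo-cons a g j (suc n))

hi-cons : ∀ a g j n → hi (cons a g) j (suc n) ≡ hi g j n
hi-cons a g zero    n = refl
hi-cons a g (suc j) n = cong (branch (g n)) (hi-cons a g j (suc n))

cons-increases : ∀ {a g n} → EventuallyIncreases g n → EventuallyIncreases (cons a g) (suc n)
cons-increases (here lt)     = here lt
cons-increases (there later) = there (cons-increases later)

cons-admissible : ∀ {a g} → a ℕ.≤ g 0 → Admissible g → Admissible (cons a g)
cons-admissible {a} {g} a≤g₀ adm = record { nondecreasing = nondecreasing′ ; increases = increases′ }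
  where
  open Admissible adm
  nondecreasing′ : Nondecreasing (cons a g)
  nondecreasing′ zero    = a≤g₀
  nondecreasing′ (suc n) = nondecreasing n
  increases′ : ∀ n → EventuallyIncreases (cons a g) n
  increases′ zero    = there (cons-increases (increases 0))
  increases′ (suc n) = cons-increases (increases n)

cons-follows : ∀ {M a g} → EventuallyFollows M g → EventuallyFollows M (cons a g)
cons-follows {a = a} {g} follows = record
  { path   = path
  ; offset = suc offset
  ; agrees = λ n → trans (cong (cons a g) (ℕₚ.+-suc n offset)) (agrees n)
  }
  where open EventuallyFollows follows

-- The field `a≤g₀` allows `a` to be prefixed as a further digit, so that the construction can be
-- iterated.
record Near (M : ℕ → ℕ) (a : ℕ) (u ε : ℚ) : Set where
  field
    g       : ℕ → ℕ
    adm     : Admissible g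
    follows : EventuallyFollows M g
    a≤g₀    : a ℕ.≤ g 0
  point : ℝ
  point = engel g (Admissible.nondecreasing adm) 0
  field
    above   : Lower point u
    below   : Upper point (u ℚ.+ ε)

-- A branch is increasing and contracting, so the same `ε` still works after prefixing a digit.
near-branch : ∀ {M a u ε} → 0ℚ ℚ.< ε → Near M a u ε → Near M a (branch a u) ε
near-branch {M} {a} {u} {ε} 0<ε near = record
  { g       = cons a g
  ; adm     = adm′
  ; follows = cons-follows follows
  ; a≤g₀    = ℕₚ.≤-refl
  ; above   = case above of λ (j , u<lo) → engel-branch-lower (cons a g) adm′ 0 {u}
      (j , subst (u ℚ.<_) (sym (lo-cons a g j 0)) u<lo)
  ; below   = case below of λ (j , hi<u+ε) →
      upper-≤ (engel (cons a g) (Admissible.nondecreasing adm′) 0) {branch a (u ℚ.+ ε)} contract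
        (engel-branch-upper (cons a g) adm′ 0 {u ℚ.+ ε}
          (j , subst (ℚ._< u ℚ.+ ε) (sym (hi-cons a g j 0)) hi<u+ε))
  }
  where
  open Near near
  adm′ : Admissible (cons a g)
  adm′ = cons-admissible a≤g₀ adm
  v : ℚ
  v = 1/1+ (suc a)
  contract : branch a (u ℚ.+ ε) ℚ.≤ branch a u ℚ.+ ε
  contract = subst (ℚ._≤ branch a u ℚ.+ ε)
    (solve 3 (λ u ε v → (con 1ℚ :+ u) :* v :+ ε :* v := (con 1ℚ :+ (u :+ ε)) :* v) refl u ε v)
    (ℚₚ.+-monoʳ-≤ (branch a u)
      (subst (ε ℚ.* v ℚ.≤_) (ℚₚ.*-identityʳ ε) (*-posˡ-≤ 0<ε (1/1+≤1 (suc a)))))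

near-0 : ∀ M a {ε} → 0ℚ ℚ.< ε → Near M a 0ℚ ε
near-0 M a {ε} 0<ε = case 1/1+-small 0<ε of λ (n , 1/1+n<ε) →
  -- Starting at level `n` or later puts the point below `ε`; starting at level `a` or later makes
  -- its first digit large enough.
  case fromLevel M (n ℕ.⊔ a) of λ (path , start) → near n 1/1+n<ε path (cong proj₁ start)
  where
  near : ∀ n → 1/1+ n ℚ.< ε → (path : Path M) →
         proj₁ (Path.position path 0) ≡ n ℕ.⊔ a → Near M a 0ℚ ε
  near n 1/1+n<ε path start = record
    { g       = g
    ; adm     = adm
    ; follows = pathDigits-follows path
    ; a≤g₀    = ℕₚ.≤-trans (ℕₚ.m≤n⊔m n a) n⊔a≤g₀
    ; above   = lower-≤ x {0ℚ} (ℚₚ.<⇒≤ (1/1+-pos (suc (g 0)))) (engel-lower g adm 0)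
    ; below   = subst (Upper x) (sym (ℚₚ.+-identityˡ ε)) (upper-≤ x {1/1+ (g 0)}
        (ℚₚ.≤-trans (1/1+-anti-≤ (ℕₚ.≤-trans (ℕₚ.m≤m⊔n n a) n⊔a≤g₀)) (ℚₚ.<⇒≤ 1/1+n<ε))
        (engel-upper g adm 0))
    }
    where
    g : ℕ → ℕ
    g = pathDigits path
    adm : Admissible g
    adm = pathDigits-admissible path
    x : ℝ
    x = engel g (Admissible.nondecreasing adm) 0
    n⊔a≤g₀ : n ℕ.⊔ a ℕ.≤ g 0
    n⊔a≤g₀ = subst (λ k → k ℕ.≤ g 0) start (k≤blockDigit (proj₁ (Path.position path 0)))

-- Over the fixed, unreduced denominator q + 1, the Engel map with digit d = a + 2 sends the
-- numerator p to d p - (q + 1).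
branch-fraction : ∀ a p p′ q → (2 ℕ.+ a) ℕ.* p ≡ suc q ℕ.+ p′ →
  branch a (fromℕ p′ ℚ.* 1/1+ q) ≡ fromℕ p ℚ.* 1/1+ q
branch-fraction a p p′ q e = begin
  (1ℚ ℚ.+ fromℕ p′ ℚ.* w) ℚ.* v
    ≡⟨ cong (λ z → (z ℚ.+ fromℕ p′ ℚ.* w) ℚ.* v) (sym (1/1+-inverse q)) ⟩
  (fromℕ (suc q) ℚ.* w ℚ.+ fromℕ p′ ℚ.* w) ℚ.* v
    ≡⟨ cong (ℚ._* v) (sym (ℚₚ.*-distribʳ-+ w (fromℕ (suc q)) (fromℕ p′))) ⟩
  (fromℕ (suc q) ℚ.+ fromℕ p′) ℚ.* w ℚ.* v
    ≡⟨ cong (λ z → z ℚ.* w ℚ.* v) (trans (sym (fromℕ-+ (suc q) p′)) (trans (cong fromℕ (sym e)) (fromℕ-homo-* (2 ℕ.+ a) p))) ⟩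
  fromℕ (2 ℕ.+ a) ℚ.* fromℕ p ℚ.* w ℚ.* v
    ≡⟨ solve 4 (λ d p w v → ((d :* p) :* w) :* v := (d :* v) :* (p :* w)) refl (fromℕ (2 ℕ.+ a)) (fromℕ p) w v ⟩
  fromℕ (2 ℕ.+ a) ℚ.* v ℚ.* (fromℕ p ℚ.* w)
    ≡⟨ cong (ℚ._* (fromℕ p ℚ.* w)) (1/1+-inverse (suc a)) ⟩
  1ℚ ℚ.* (fromℕ p ℚ.* w)
    ≡⟨ ℚₚ.*-identityˡ (fromℕ p ℚ.* w) ⟩
  fromℕ p ℚ.* w ∎
  where
  open ≡-Reasoning
  v w : ℚ
  v = 1/1+ (suc a)
  w = 1/1+ q

-- The finite Engel expansion of (p + 1)/(q + 1): the numerator decreases under T.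
near-fraction : ∀ M q {ε} → 0ℚ ℚ.< ε → ∀ p → suc p ℕ.≤ q →
  Near M (ℕ.pred (q ℕ./ suc p)) (fromℕ (suc p) ℚ.* 1/1+ q) ε
near-fraction M q {ε} 0<ε = <-rec _ expand
  where
  NearFraction : ℕ → Set
  NearFraction p = suc p ℕ.≤ q → Near M (ℕ.pred (q ℕ./ suc p)) (fromℕ (suc p) ℚ.* 1/1+ q) ε

  weaken : ∀ {a b u} → a ℕ.≤ b → Near M b u ε → Near M a u ε
  weaken a≤b near = record
    { g = g ; adm = adm ; follows = follows ; a≤g₀ = ℕₚ.≤-trans a≤b a≤g₀ ; above = above ; below = below }
    where open Near near

  expand : ∀ p → (∀ {r} → r ℕ.< p → NearFraction r) → NearFraction p
  expand p rec p<q = subst (λ u → Near M a u ε) (branch-fraction a (suc p) (p ℕ.∸ R) q numerator)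
    (near-branch 0<ε (tail (p ℕ.∸ R) (ℕₚ.m∸n≤m p R)))
    where
    -- Q + 1 is the ceiling of (q + 1)/(p + 1), that is, the digit `2 ℕ.+ a`. The next numerator is
    -- (Q + 1)(p + 1) - (q + 1) = p - R.
    Q R a : ℕ
    Q = q ℕ./ suc p
    R = q ℕ.% suc p
    a = ℕ.pred Q
    R≤p : R ℕ.≤ p
    R≤p = ℕₚ.≤-pred (m%n<n q (suc p))
    1+a≡Q : suc a ≡ Q
    1+a≡Q = ℕₚ.suc-pred Q {{ℕ.>-nonZero (m≥n⇒m/n>0 p<q)}}
    numerator : (2 ℕ.+ a) ℕ.* suc p ≡ suc q ℕ.+ (p ℕ.∸ R)
    numerator = begin
      suc (p ℕ.+ suc a ℕ.* suc p)                      ≡⟨ cong (λ n → suc (p ℕ.+ n ℕ.* suc p)) 1+a≡Q ⟩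
      suc (p ℕ.+ Q ℕ.* suc p)                          ≡⟨ cong (λ n → suc (n ℕ.+ Q ℕ.* suc p)) (sym (ℕₚ.m+[n∸m]≡n R≤p)) ⟩
      suc (R ℕ.+ (p ℕ.∸ R) ℕ.+ Q ℕ.* suc p)            ≡⟨ cong suc (ℕ-solve 3 (λ r s t → r ⊕ s ⊕ t ⊜ r ⊕ t ⊕ s) refl R (p ℕ.∸ R) (Q ℕ.* suc p)) ⟩
      suc (R ℕ.+ Q ℕ.* suc p ℕ.+ (p ℕ.∸ R))            ≡⟨ cong (λ n → suc (n ℕ.+ (p ℕ.∸ R))) (sym (m≡m%n+[m/n]*n q (suc p))) ⟩
      suc (q ℕ.+ (p ℕ.∸ R))                            ∎
      where open ≡-Reasoning
    tail : ∀ p′ → p′ ℕ.≤ p → Near M a (fromℕ p′ ℚ.* 1/1+ q) ε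
    -- The expansion of the rational ends here, and the infinite tail of late levels is attached.
    tail zero    _   = subst (λ u → Near M a u ε) (sym (ℚₚ.*-zeroˡ (1/1+ q))) (near-0 M a 0<ε)
    tail (suc r) r<p = weaken
      -- A smaller numerator has a larger quotient, so the digits do not decrease.
      (ℕₚ.pred-mono-≤ (/-monoʳ-≤ q (ℕₚ.≤-trans r<p (ℕₚ.n≤1+n p))))
      (rec r<p (ℕₚ.≤-trans r<p (ℕₚ.≤-trans (ℕₚ.n≤1+n p) p<q)))

denominator-* : ∀ n d .(c : Coprime n (suc d)) → fromℕ (suc d) ℚ.* ℚ.mkℚ (+ n) d c ≡ fromℕ n
denominator-* n d c = ℚₚ.toℚᵘ-injective
  (ℚᵘₚ.≃-trans (ℚₚ.toℚᵘ-homo-* (fromℕ (suc d)) (ℚ.mkℚ (+ n) d c))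
  (ℚᵘₚ.≃-trans (ℚᵘₚ.*-congʳ (ℚₚ.toℚᵘ-fromℚᵘ (ℚᵘ.mkℚᵘ (+ suc d) 0)))
  (ℚᵘₚ.≃-trans (ℚᵘ.*≡* eq) (ℚᵘₚ.≃-sym (ℚₚ.toℚᵘ-fromℚᵘ (ℚᵘ.mkℚᵘ (+ n) 0))))))
  where
  eq : (+ suc d ℤ.* + n) ℤ.* + 1 ≡ + n ℤ.* (+ 1 ℤ.* + suc d)
  eq = trans (ℤₚ.*-identityʳ (+ suc d ℤ.* + n)) (trans (ℤₚ.*-comm (+ suc d) (+ n))
    (cong (+ n ℤ.*_) (sym (ℤₚ.*-identityˡ (+ suc d)))))

proper-fraction : ∀ u → 0ℚ ℚ.< u → u ℚ.< 1ℚ →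
  ∃[ p ] ∃[ q ] suc p ℕ.≤ q × fromℕ (suc p) ℚ.* 1/1+ q ≡ u
proper-fraction (ℚ.mkℚ -[1+ n ] d c) 0<u _ = ⊥-elim (negative (ℚₚ.drop-*<* 0<u))
  where
  negative : ¬ (+ 0 ℤ.* + suc d ℤ.< -[1+ n ] ℤ.* + 1)
  negative ()
proper-fraction (ℚ.mkℚ (+ zero) d c) 0<u _ = ⊥-elim (ℚₚ.<-irrefl refl
  (subst (0ℚ ℚ.<_) (denominator-* 0 d c) (*-pos (0<fromℕ-suc d) 0<u)))
proper-fraction u@(ℚ.mkℚ (+ suc p) d c) 0<u u<1 = p , d , ℕₚ.≤-pred (ℕₚ.≰⇒> d<p⇒⊥) ,
  trans (cong (ℚ._* 1/1+ d) (sym (denominator-* (suc p) d c)))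
  (trans (solve 3 (λ d u w → (d :* u) :* w := (d :* w) :* u) refl (fromℕ (suc d)) u (1/1+ d))
  (trans (cong (ℚ._* u) (1/1+-inverse d)) (ℚₚ.*-identityˡ u)))
  where
  d<p⇒⊥ : ¬ (suc d ℕ.≤ suc p)
  d<p⇒⊥ d≤p = ℚₚ.<-irrefl refl (ℚₚ.<-≤-trans
    (subst₂ ℚ._<_ (denominator-* (suc p) d c) (ℚₚ.*-identityʳ (fromℕ (suc d))) (*-posˡ-< (0<fromℕ-suc d) u<1))
    (fromℕ-mono-≤ d≤p))

dense : ∀ α → DenseIn01 (LevelSet α)
dense α y (q₀ , 0<q₀ , Lq₀) (q₁ , Uq₁ , q₁<1) a b (r , Ua , Lr) (v , Uv , Lv) =
  -- The larger of `q₀` and `r` is a positive rational between `a` and `y`.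
  case ℚₚ.≤-total q₀ r of λ
    { (inj₁ q₀≤r) → between r  Ua                (ℚₚ.<-≤-trans 0<q₀ q₀≤r) Lr
    ; (inj₂ r≤q₀) → between q₀ (upper-≤ a r≤q₀ Ua) 0<q₀                     Lq₀
    }
  where
  between : ∀ u → Upper a u → 0ℚ ℚ.< u → Lower y u →
            Σ[ x ∈ ℝ ] (LevelSet α x × a <ᴿ x × x <ᴿ b)
  between u Uu 0<u Lu =
    case proper-fraction u 0<u (ℚₚ.<-trans (lower<upper y Lu Uq₁) q₁<1) of λ (p , q , p<q , u≡) →
    case calibrated α of λ (M , cal) →
    found cal (subst (λ u′ → Near M (ℕ.pred (q ℕ./ suc p)) u′ (v ℚ.- u)) u≡
      (near-fraction M q (<⇒0<- (lower<upper y Lu Uv)) p p<q))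
    where
    found : ∀ {M c} → Calibrated M α → Near M c u (v ℚ.- u) →
            Σ[ x ∈ ℝ ] (LevelSet α x × a <ᴿ x × x <ᴿ b)
    found cal near = point , inLevelSet α cal adm follows , (u , Uu , above) ,
      (v , subst (Upper point) (p+[q-p]≡q u v) below , Lv)
      where open Near near

theorem3p2 : ∀ (α : [0,∞]) → Uncountable (LevelSet α) × DenseIn01 (LevelSet α)
theorem3p2 α = uncountable α , dense α
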